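{- Let $n$ be a positive even integer. Then $\rho(n,n)=\left(\left(\tfrac n2\right)!\right)^4$. Furthermore, for $BT\in\mathcal{D}_n$ one has ${\rm per}(A_{BT})=\rho(n,n)$ if and only if $BT$ is isomorphic to $BT_0(n,n)$.
   Context: $K_{n,n}$ is the complete bipartite graph with parts $X=\{x_1,\dots,x_n\}$ and $Y=\{y_1,\dots,y_n\}$. $\mathcal{D}_n$ is the set of all bipartite tournaments of size $n$ by $n$, i.e. all digraphs obtained from $K_{n,n}$ by assigning a direction to each edge. $A_{BT}$ is the $(0,1)$ adjacency matrix of $BT$, of order $2n$, ${\rm per}$ is the permanent, and $\rho(n,n):=\max_{BT\in\mathcal{D}_n}{\rm per}(A_{BT})$. For even $n$, $BT_0(n,n)$ is the bipartite tournament in which all edges between $\{x_1,\dots,x_{n/2}\}$ and $\{y_1,\dots,y_{n/2}\}$ and all edges between $\{x_{n/2+1},\dots,x_n\}$ and $\{y_{n/2+1},\dots,y_n\}$ are directed from $X$ to $Y$, and all other edges (between the first half of one part and the second half of the other part) are directed from $Y$ to $X$. -}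

module Defs where

open import Data.Bool.Base using (Bool; true; false; if_then_else_)
open import Data.Fin.Base using (Fin; zero; suc; toℕ; splitAt; punchIn)
open import Data.Fin.Permutation as Perm
  using (Permutation′; _⟨$⟩ʳ_; insert; remove; insert-remove)
open import Data.Fin.Properties using (punchIn-injective)
open import Data.List.Base using (List; []; _∷_; map; allFin; cartesianProductWith)
open import Data.List.Extrema.Nat using (max; xs≤max; argmax-sel)
import Data.List.Membership.Propositional as Membership
import Data.List.Membership.Propositional.Properties as Membershipₚ
import Data.List.Membership.Setoid as MembershipS
import Data.List.Membership.Setoid.Properties as MembershipSₚ
open import Data.List.Properties using (map-cong)
import Data.List.Relation.Unary.All as All
open import Data.List.Relation.Unary.Any using (here; there)
import Data.List.Relation.Unary.AllPairs as AllPairs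
open import Data.List.Relation.Unary.Enumerates.Setoid using (IsEnumeration)
open import Data.List.Relation.Unary.Unique.Setoid using (Unique)
import Data.List.Relation.Unary.Unique.Setoid.Properties as Uniqueₚ
import Data.List.Relation.Unary.Unique.Propositional.Properties as UniqueₚP
open import Data.Nat.Base using (ℕ; zero; suc; _+_; _*_; _/_; _≤_; _<ᵇ_)
open import Data.Nat.ListAction using (sum)
open import Data.Nat.Properties using (*-1-commutativeMonoid; n≤0⇒n≡0)
open import Data.Product.Base using (Σ; ∃; _×_; _,_)
open import Data.Sum.Base using (_⊎_; inj₁; inj₂)
open import Data.Vec.Functional using (Vector) renaming ([] to []ᵥ; _∷_ to _∷ᵥ_)
open import Data.Vec.Functional.Relation.Binary.Equality.Setoid using (≋-setoid)
open import Function.Base using (id; _∘_)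
open import Function.Bundles using (_↔_; Inverse)
open import Level using (0ℓ)
open import Relation.Binary.Bundles using (Setoid)
open import Relation.Binary.PropositionalEquality
  using (_≡_; refl; sym; trans; cong; subst; setoid)
open import Algebra.Properties.CommutativeMonoid.Sum *-1-commutativeMonoid
  using () renaming (sum to ∏; sum-cong-≗ to ∏-cong)

------------------------------------------------------------------------
-- Permanents

-- One representative of every permutation of Fin m, up to pointwise
-- equality: see permutations-complete and permutations-unique.
permutations : ∀ m → List (Permutation′ m)
permutations zero    = Perm.id ∷ []
permutations (suc m) =
  cartesianProductWith (insert zero) (allFin (suc m)) (permutations m)

Matrix : ℕ → Set
Matrix m = Fin m → Fin m → ℕ

per : ∀ {m} → Matrix m → ℕ
per {m} A = sum (map (λ σ → ∏ (λ i → A i (σ ⟨$⟩ʳ i))) (permutations m))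

------------------------------------------------------------------------
-- Digraphs

Digraph : Set → Set
Digraph V = V → V → Bool

infix 4 _≅_

_≅_ : ∀ {V W} → Digraph V → Digraph W → Set
_≅_ {V} {W} G H =
  Σ (V ↔ W) λ f → ∀ u v → G u v ≡ H (Inverse.to f u) (Inverse.to f v)

------------------------------------------------------------------------
-- Bipartite tournaments

Vertex : ℕ → Set
Vertex n = Fin n ⊎ Fin n

pattern x[_] i = inj₁ i
pattern y[_] j = inj₂ j

data Direction : Set where
  X⇒Y Y⇒X : Direction

-- T i j is the direction given to the edge between x[ i ] and y[ j ] in K_{n,n}.
BipartiteTournament : ℕ → Set
BipartiteTournament n = Fin n → Fin n → Direction

isX⇒Y isY⇒X : Direction → Bool
isX⇒Y X⇒Y = true
isX⇒Y Y⇒X = false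
isY⇒X X⇒Y = false
isY⇒X Y⇒X = true

digraph : ∀ {n} → BipartiteTournament n → Digraph (Vertex n)
digraph T x[ i ] x[ _ ] = false
digraph T x[ i ] y[ j ] = isX⇒Y (T i j)
digraph T y[ j ] x[ i ] = isY⇒X (T i j)
digraph T y[ j ] y[ _ ] = false

-- Rows and columns are indexed by the vertices in the order
-- x₁, …, xₙ, y₁, …, yₙ.
adjacency : ∀ {n} → BipartiteTournament n → Matrix (n + n)
adjacency {n} T u v =
  if digraph T (splitAt n u) (splitAt n v) then 1 else 0

inFirstHalf : ∀ {n} → Fin n → Bool
inFirstHalf {n} i = toℕ i <ᵇ n / 2

fromHalves : Bool → Bool → Direction
fromHalves true  true  = X⇒Y
fromHalves false false = X⇒Y
fromHalves true  false = Y⇒X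
fromHalves false true  = Y⇒X

BT₀ : ∀ n → BipartiteTournament n
BT₀ n i j = fromHalves (inFirstHalf i) (inFirstHalf j)

------------------------------------------------------------------------
-- The maximal permanent

vectors : {A : Set} → List A → ∀ n → List (Vector A n)
vectors as zero    = []ᵥ ∷ []
vectors as (suc n) = cartesianProductWith _∷ᵥ_ as (vectors as n)

bipartiteTournaments : ∀ n → List (BipartiteTournament n)
bipartiteTournaments n = vectors (vectors (X⇒Y ∷ Y⇒X ∷ []) n) n

-- ρ n is ρ(n,n).  The base value 0 is harmless: see ρ-attained.
ρ : ℕ → ℕ
ρ n = max 0 (map (per ∘ adjacency) (bipartiteTournaments n))

------------------------------------------------------------------------
-- permutations lists every permutation exactly once

permutationSetoid : ℕ → Setoid 0ℓ 0ℓ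
permutationSetoid m = record
  { Carrier       = Permutation′ m
  ; _≈_           = Perm._≈_
  ; isEquivalence = record
    { refl  = λ _ → refl
    ; sym   = λ p i → sym (p i)
    ; trans = λ p q i → trans (p i) (q i)
    }
  }

private
  insert-zero-cong : ∀ {m} {j k : Fin (suc m)} {π σ : Permutation′ m} →
    j ≡ k → π Perm.≈ σ → insert zero j π Perm.≈ insert zero k σ
  insert-zero-cong         j≡k  π≈σ zero    = j≡k
  insert-zero-cong {j = j} refl π≈σ (suc i) = cong (punchIn j) (π≈σ i)

  insert-zero-injective : ∀ {m} {j k : Fin (suc m)} {π σ : Permutation′ m} →
    insert zero j π Perm.≈ insert zero k σ → j ≡ k × π Perm.≈ σ
  insert-zero-injective {j = j} eq with eq zero
  ... | refl = refl , λ i → punchIn-injective j _ _ (eq (suc i))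

permutations-complete : ∀ m → IsEnumeration (permutationSetoid m) (permutations m)
permutations-complete zero    π = here λ ()
permutations-complete (suc m) π =
  MembershipSₚ.∈-resp-≈ (permutationSetoid (suc m))
    {x = insert zero (π ⟨$⟩ʳ zero) (remove zero π)} {y = π}
    (insert-remove zero π)
    (MembershipSₚ.∈-cartesianProductWith⁺
      (setoid _) (permutationSetoid m) (permutationSetoid (suc m))
      {f = insert zero}
      (λ {j} {k} {π} {σ} → insert-zero-cong {π = π} {σ = σ})
      (Membershipₚ.∈-allFin (π ⟨$⟩ʳ zero))
      (permutations-complete m (remove zero π)))

permutations-unique : ∀ m → Unique (permutationSetoid m) (permutations m)
permutations-unique zero    = All.[] AllPairs.∷ AllPairs.[]
permutations-unique (suc m) =
  Uniqueₚ.cartesianProductWith⁺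
    (setoid _) (permutationSetoid m) (permutationSetoid (suc m))
    (insert zero)
    (λ {_} {_} {π} {σ} → insert-zero-injective {π = π} {σ = σ})
    (UniqueₚP.allFin⁺ (suc m))
    (permutations-unique m)

------------------------------------------------------------------------
-- ρ n is the maximum of the permanents

bipartiteTournamentSetoid : ℕ → Setoid 0ℓ 0ℓ
bipartiteTournamentSetoid n = ≋-setoid (≋-setoid (setoid Direction) n) n

vectors-complete : (S : Setoid 0ℓ 0ℓ) {as : List (Setoid.Carrier S)} →
  IsEnumeration S as → ∀ n → IsEnumeration (≋-setoid S n) (vectors as n)
vectors-complete S complete zero    v = here λ ()
vectors-complete S complete (suc n) v =
  MembershipSₚ.∈-resp-≈ (≋-setoid S (suc n))
    (λ { zero → Setoid.refl S ; (suc _) → Setoid.refl S })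
    (MembershipSₚ.∈-cartesianProductWith⁺ S (≋-setoid S n) (≋-setoid S (suc n))
      {f = _∷ᵥ_}
      (λ p q → λ { zero → p ; (suc i) → q i })
      (complete (v zero))
      (vectors-complete S complete n (v ∘ suc)))

bipartiteTournaments-complete : ∀ n →
  IsEnumeration (bipartiteTournamentSetoid n) (bipartiteTournaments n)
bipartiteTournaments-complete n =
  vectors-complete (≋-setoid (setoid Direction) n)
    (vectors-complete (setoid Direction)
      (λ { X⇒Y → here refl ; Y⇒X → there (here refl) }) n) n

per-cong : ∀ {m} {A B : Matrix m} → (∀ i j → A i j ≡ B i j) → per A ≡ per B
per-cong {m} A≡B =
  cong sum (map-cong (λ σ → ∏-cong (λ i → A≡B i (σ ⟨$⟩ʳ i))) (permutations m))

adjacency-cong : ∀ {n} {T U : BipartiteTournament n} →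
  (∀ i j → T i j ≡ U i j) → ∀ u v → adjacency T u v ≡ adjacency U u v
adjacency-cong {n} T≡U u v with splitAt n u | splitAt n v
... | x[ i ] | x[ _ ] = refl
... | x[ i ] | y[ j ] = cong (λ d → if isX⇒Y d then 1 else 0) (T≡U i j)
... | y[ j ] | x[ i ] = cong (λ d → if isY⇒X d then 1 else 0) (T≡U i j)
... | y[ j ] | y[ _ ] = refl

private
  per∈ : ∀ {n} (T : BipartiteTournament n) → per (adjacency T)
    Membership.∈ map (per ∘ adjacency) (bipartiteTournaments n)
  per∈ {n} T = MembershipSₚ.∈-resp-≈ (setoid ℕ) refl
    (MembershipSₚ.∈-map⁺ (bipartiteTournamentSetoid n) (setoid ℕ)
      (λ eq → per-cong (adjacency-cong eq))
      (bipartiteTournaments-complete n T))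

ρ-upper : ∀ {n} (T : BipartiteTournament n) → per (adjacency T) ≤ ρ n
ρ-upper {n} T = All.lookup (xs≤max 0 _) (per∈ T)

ρ-attained : ∀ n → ∃ λ (T : BipartiteTournament n) → per (adjacency T) ≡ ρ n
ρ-attained n
  with argmax-sel id 0 (map (per ∘ adjacency) (bipartiteTournaments n))
... | inj₁ ρ≡0 =
      BT₀ n , trans (n≤0⇒n≡0 (subst (per (adjacency (BT₀ n)) ≤_) ρ≡0 (ρ-upper (BT₀ n)))) (sym ρ≡0)
... | inj₂ ρ∈
      with Membershipₚ.∈-map⁻ (per ∘ adjacency) ρ∈
...      | T , _ , eq = T , sym eq

{-# OPTIONS --safe #-}

-- Split the adjacency matrix into the X → Y block B and the Y → X block J − Bᵀ:
-- its permanent is per B · per (J − B).  Bregman's bound per B ≤ ∏ᵢ g(rᵢ), with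
-- g(r) = (r!)^(1/r) and row sums rᵢ, together with g(r) g(n − r) ≤ g(n/2)²,
-- strict unless r = n/2, gives ρ(n,n) ≤ ((n/2)!)⁴.  Schrijver's proof of
-- Bregman's bound works in ℕ after replacing g by its L-th power G, where
-- L = n!.  Equality forces all row and column sums to be n/2; it also forces
-- rᵢ per B(i|k) = per B whenever Bᵢₖ = 1, and equality for the minor B(i|k), so
-- that two rows sharing a column coincide.  Hence B is J ⊕ J up to permutations.
module Submission where

open import Defs
open import Data.Nat using (ℕ; _<_; _^_; _/_; _!)
open import Data.Nat.Divisibility using (_∣_)
open import Data.Product using (_×_)
open import Function.Bundles using (_⇔_)
open import Relation.Binary.PropositionalEquality using (_≡_)
open import Data.Bool.Base using (Bool; true; false; if_then_else_)
import Data.Bool.Properties as Bool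
open import Data.Empty using (⊥; ⊥-elim)
open import Data.Fin.Base using (Fin; zero; suc; punchIn; punchOut; splitAt; join; _↑ˡ_; _↑ʳ_; toℕ)
open import Data.Fin.Permutation as Perm
  using (Permutation′; _⟨$⟩ʳ_; _⟨$⟩ˡ_; insert; flip; _∘ₚ_; inverseˡ; inverseʳ; permutation)
import Data.Fin.Properties as Fin
open import Data.List.Base using (List; []; _∷_; map; _++_; cartesianProductWith; tabulate)
open import Data.List.Properties using (map-++; map-∘; map-cong)
import Data.List.Membership.Setoid as SetoidMembership
import Data.List.Membership.Setoid.Properties as SetoidMembershipₚ
open import Data.List.Relation.Unary.All as All using (All)
open import Data.List.Relation.Unary.AllPairs using (_∷_)
open import Data.List.Relation.Unary.Any using (here; there; _─_)
open import Data.List.Relation.Unary.Enumerates.Setoid using (IsEnumeration)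
open import Data.List.Relation.Unary.Unique.Setoid using (Unique)
import Data.List.Relation.Unary.Unique.Setoid.Properties as Uniqueₚ
open import Data.Nat.Base
open import Data.Nat.Divisibility using (divides; m≤n⇒m!∣n!; ∣-trans; m∣m*n)
open import Data.Nat.DivMod using (m/n*n≡m; m*n/n≡m)
open import Data.Nat.ListAction using (sum)
open import Data.Nat.ListAction.Properties using (sum-++)
open import Data.Nat.Properties
open import Data.Nat.Tactic.RingSolver using (solve-∀)
open import Data.Product using (_,_; ∃; proj₁; proj₂)
open import Data.Sum as Sum using (_⊎_; inj₁; inj₂)
open import Data.Sum.Function.Propositional using (_⊎-↔_)
open import Data.Sum.Properties using (swap-involutive)
open import Function.Base using (_∘_; id)
open import Function.Bundles using (_↔_; Inverse; mk↔ₛ′; mk⇔)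
open import Level using (0ℓ)
open import Relation.Binary.Bundles using (Setoid)
open import Relation.Binary.PropositionalEquality
open import Relation.Nullary using (¬_; yes; no; contradiction)
open import Algebra.Properties.Semiring.Sum +-*-semiring
  using (sum-remove; ∑-distrib-+; sum-cong-≗; *-distribʳ-sum) renaming (sum to ∑)
open import Algebra.Properties.CommutativeMonoid.Sum *-1-commutativeMonoid
  using () renaming (sum to ∏; sum-remove to ∏-remove; ∑-distrib-+ to ∏-distrib-*;
                     ∑-comm to ∏-comm; sum-cong-≗ to ∏-cong; sum-permute to ∏-permute)

-- Schrijver's proof raises `per A` to the power `n * per A`, so that the expansions along all n
-- rows can be multiplied. In each row, convexity of x log x brings in the permanents of the minors,
-- each with exponent `w i k`, the number of nonzero diagonals through the entry. These exponents
-- sum to `per A` along columns as well as along rows, so exchanging the two products rebuilds the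
-- bound for A itself. Logarithms never appear: a sum of t log t becomes a product of powers t ^ t,
-- with 0 ^ 0 = 1. The price is that common factors and exponents have to be cancelled, so
-- positivity accompanies the argument, and inequalities whose equality case matters come with a
-- strict twin. One exponent L has to serve all sizes up to n, because the induction compares a
-- matrix with its minors through the same G; every positive r ≤ n divides n!. Log-concavity of G
-- starts only at r = 1, so zero permanents are split off before row sums are compared.

private variable m n : ℕ

-- Weighted AM-GM and the log sum inequality in ℕ

^-distribʳ-* : ∀ m n o → (m * n) ^ o ≡ m ^ o * n ^ o
^-distribʳ-* m n zero    = refl
^-distribʳ-* m n (suc o) = begin
  m * n * (m * n) ^ o       ≡⟨ cong (m * n *_) (^-distribʳ-* m n o) ⟩
  m * n * (m ^ o * n ^ o)   ≡⟨ eq m n (m ^ o) (n ^ o) ⟩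
  m * m ^ o * (n * n ^ o)   ∎
  where
  open ≡-Reasoning
  eq : ∀ a b c d → a * b * (c * d) ≡ a * c * (b * d)
  eq = solve-∀

^-cancelʳ-≤ : ∀ o .{{_ : NonZero o}} {m n} → m ^ o ≤ n ^ o → m ≤ n
^-cancelʳ-≤ o m^o≤n^o = ≮⇒≥ λ n<m → <⇒≱ (^-monoˡ-< o n<m) m^o≤n^o

^-cancelʳ-< : ∀ o {m n} → m ^ o < n ^ o → m < n
^-cancelʳ-< o m^o<n^o = ≰⇒> λ n≤m → <⇒≱ m^o<n^o (^-monoˡ-≤ o n≤m)

^-cancelʳ-≡ : ∀ o .{{_ : NonZero o}} {m n} → m ^ o ≡ n ^ o → m ≡ n
^-cancelʳ-≡ o eq = ≤-antisym (^-cancelʳ-≤ o (≤-reflexive eq)) (^-cancelʳ-≤ o (≤-reflexive (sym eq)))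

^-pos : ∀ {m} n → 0 < m → 0 < m ^ n
^-pos n 0<m = m^n>0 _ {{>-nonZero 0<m}} n

n^n>0 : ∀ n → 0 < n ^ n
n^n>0 zero    = z<s
n^n>0 (suc n) = m^n>0 (suc n) (suc n)

*-pos : ∀ {m n} → 0 < m → 0 < n → 0 < m * n
*-pos 0<m 0<n = *-mono-≤ 0<m 0<n

*-posˡ : ∀ m {n} → 0 < m * n → 0 < m
*-posˡ (suc m) _ = z<s

*-posʳ : ∀ m {n} → 0 < m * n → 0 < n
*-posʳ m {n} 0<mn = *-posˡ n (subst (0 <_) (*-comm m n) 0<mn)

*-cancelˡ-≤⁺ : ∀ {o m n} → 0 < o → o * m ≤ o * n → m ≤ n
*-cancelˡ-≤⁺ {o} 0<o = *-cancelˡ-≤ o {{>-nonZero 0<o}}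

*-cancelˡ-<⁺ : ∀ o {m n} → o * m < o * n → m < n
*-cancelˡ-<⁺ o = *-cancelˡ-< o _ _

*-cancelˡ-≡⁺ : ∀ {o m n} → 0 < o → o * m ≡ o * n → m ≡ n
*-cancelˡ-≡⁺ {o} 0<o = *-cancelˡ-≡ _ _ o {{>-nonZero 0<o}}

*-monoʳ-<⁺ : ∀ {o m n} → 0 < o → m < n → o * m < o * n
*-monoʳ-<⁺ {o} 0<o = *-monoʳ-< o {{>-nonZero 0<o}}

*-tight : ∀ {a b c d} → a ≤ c → b ≤ d → 0 < a → 0 < b → a * b ≡ c * d → a ≡ c × b ≡ d
*-tight {a} {b} {c} {d} a≤c b≤d 0<a 0<b eq =
    ≤-antisym a≤c (≮⇒≥ λ a<c → <⇒≢ (<-≤-trans (*-monoˡ-< b {{>-nonZero 0<b}} a<c) (*-monoʳ-≤ c b≤d)) eq)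
  , ≤-antisym b≤d (≮⇒≥ λ b<d → <⇒≢ (<-≤-trans (*-monoʳ-<⁺ 0<a b<d) (*-monoˡ-≤ d a≤c)) eq)

2xy≤x²+y² : ∀ x y → 2 * (x * y) ≤ x * x + y * y
2xy≤x²+y² x y with ≤-total x y
... | inj₁ x≤y = subst (λ y → 2 * (x * y) ≤ x * x + y * y) (m+[n∸m]≡n x≤y)
      (≤-trans (m≤m+n _ _) (≤-reflexive (eq x (y ∸ x))))
      where
      eq : ∀ x k → 2 * (x * (x + k)) + k * k ≡ x * x + (x + k) * (x + k)
      eq = solve-∀
... | inj₂ y≤x = subst (λ x → 2 * (x * y) ≤ x * x + y * y) (m+[n∸m]≡n y≤x)
      (≤-trans (m≤m+n _ _) (≤-reflexive (eq y (x ∸ y))))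
      where
      eq : ∀ x k → 2 * ((x + k) * x) + k * k ≡ (x + k) * (x + k) + x * x
      eq = solve-∀

2xy<x²+y² : ∀ {x y} → x ≢ y → 2 * (x * y) < x * x + y * y
2xy<x²+y² {x} {y} x≢y = ≤∧≢⇒< (2xy≤x²+y² x y) λ eq → x≢y (go (≤-total x y) eq)
  where
  open ≡-Reasoning
  go₁ : ∀ x k → 2 * (x * (x + k)) ≡ x * x + (x + k) * (x + k) → k ≡ 0
  go₁ x zero    _  = refl
  go₁ x (suc k) eq = contradiction (trans eq (id₁ x (suc k))) (m≢1+m+n (2 * (x * (x + suc k))) ∘ (λ e → trans e (+-suc _ _)))
    where
    id₁ : ∀ x k → x * x + (x + k) * (x + k) ≡ 2 * (x * (x + k)) + k * k
    id₁ = solve-∀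
  go : _ → 2 * (x * y) ≡ x * x + y * y → x ≡ y
  go (inj₁ x≤y) eq = ≤-antisym x≤y (m∸n≡0⇒m≤n (go₁ x (y ∸ x)
    (subst (λ y → 2 * (x * y) ≡ x * x + y * y) (sym (m+[n∸m]≡n x≤y)) eq)))
  go (inj₂ y≤x) eq = ≤-antisym (m∸n≡0⇒m≤n (go₁ y (x ∸ y)
    (subst (λ x → 2 * (y * x) ≡ y * y + x * x) (sym (m+[n∸m]≡n y≤x))
      (trans (cong (2 *_) (*-comm y x)) (trans eq (+-comm (x * x) (y * y))))))) y≤x

-- AM-GM for x and M copies of y, in additive form.
amgm : ∀ M x y → suc M * (x * y ^ M) ≤ x ^ suc M + M * y ^ suc M

private
  -- The case M times x, plus (M + 1) y^M times 2xy ≤ x² + y², is the case M + 1 after cancelling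
  -- `common`. The last inequality stays a parameter so that the strict version shares the algebra.
  module AMGMStep (M x y : ℕ) where
    b = y ^ M
    common = suc M * (x * x * b) + M * (x * y * b)

    lhs : ∀ M x y b → suc M * (x * x * b) + suc M * b * (2 * (x * y)) ≡
      suc M * (x * x * b) + M * (x * y * b) + suc (suc M) * (x * (y * b))
    lhs = solve-∀

    rhs : ∀ M x y b c → x * (c + M * (y * b)) + suc M * b * (x * x + y * y) ≡
      suc M * (x * x * b) + M * (x * y * b) + (x * c + suc M * (y * (y * b)))
    rhs = solve-∀

    ih : suc M * (x * x * b) ≤ x * (x ^ suc M + M * (y * b))
    ih = ≤-trans (≤-reflexive (eq M x b)) (*-monoʳ-≤ x (amgm M x y))
      where
      eq : ∀ M x b → suc M * (x * x * b) ≡ x * (suc M * (x * b))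
      eq = solve-∀

    step-≤ : suc M * b * (2 * (x * y)) ≤ suc M * b * (x * x + y * y) →
      suc (suc M) * (x * y ^ suc M) ≤ x ^ suc (suc M) + suc M * y ^ suc (suc M)
    step-≤ h = +-cancelˡ-≤ common _ _
      (subst₂ _≤_ (lhs M x y b) (rhs M x y b (x ^ suc M)) (+-mono-≤ ih h))

    step-< : suc M * b * (2 * (x * y)) < suc M * b * (x * x + y * y) →
      suc (suc M) * (x * y ^ suc M) < x ^ suc (suc M) + suc M * y ^ suc (suc M)
    step-< h = +-cancelˡ-< common _ _
      (subst₂ _<_ (lhs M x y b) (rhs M x y b (x ^ suc M)) (+-mono-≤-< ih h))

amgm zero    x y = ≤-reflexive (eq x)
  where
  eq : ∀ x → 1 * (x * 1) ≡ x * 1 + 0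
  eq = solve-∀
amgm (suc M) x y = AMGMStep.step-≤ M x y (*-monoʳ-≤ (suc M * y ^ M) (2xy≤x²+y² x y))

amgm-< : ∀ M {x y} → x ≢ y → suc (suc M) * (x * y ^ suc M) < x ^ suc (suc M) + suc M * y ^ suc (suc M)
amgm-< M {x} {suc y} x≢y = AMGMStep.step-< M x (suc y)
  (*-monoʳ-<⁺ (*-pos {suc M} z<s (^-pos {suc y} M z<s)) (2xy<x²+y² x≢y))
amgm-< M {zero} {zero}  x≢y = contradiction refl x≢y
-- The factor `y ^ M` of the inductive step can vanish here; strictness comes instead from the left
-- side being 0.
amgm-< M {suc x} {zero} x≢y = subst (_< suc x ^ suc (suc M) + suc M * 0)
  (sym (trans (cong (suc (suc M) *_) (*-zeroʳ (suc x))) (*-zeroʳ (suc (suc M)))))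
  (<-≤-trans (^-pos {suc x} (suc (suc M)) z<s) (m≤m+n _ _))

private
  module MeanStep (N S x : ℕ) where
    -- The new mean (S + x)/(N + 1) and the old mean S/N, both multiplied by N (N + 1). AM-GM is
    -- applied to one copy of p and N copies of q.
    p = N * (S + x)
    q = suc N * S

    lhs : suc N * (p * q ^ N) ≡ N * (suc N ^ suc N * S ^ suc N) + N * (suc N ^ suc N * (x * S ^ N))
    lhs = trans (cong (λ z → suc N * (p * z)) (^-distribʳ-* (suc N) S N)) (eq N S x (suc N ^ N) (S ^ N))
      where
      eq : ∀ N S x e s → suc N * (N * (S + x) * (e * s)) ≡
        N * (suc N * e * (S * s)) + N * (suc N * e * (x * s))
      eq = solve-∀

    common = N * (suc N ^ suc N * S ^ suc N)

    rhs : p ^ suc N + N * q ^ suc N ≡ N * (suc N ^ suc N * S ^ suc N) + N * ((S + x) ^ suc N * N ^ N)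
    rhs = trans (cong₂ (λ y z → y + N * z) (^-distribʳ-* N (S + x) (suc N)) (^-distribʳ-* (suc N) S (suc N)))
                (eq N (N ^ N) ((S + x) ^ suc N) (suc N ^ suc N * S ^ suc N))
      where
      eq : ∀ N g f h → N * g * f + N * h ≡ N * h + N * (f * g)
      eq = solve-∀

-- The first factors are S, the sum of N numbers, and x, a further number:
-- (mean)ᴺ / product does not decrease when x is appended.
mean-step : ∀ N S x → suc N ^ suc N * (x * S ^ N) ≤ (S + x) ^ suc N * N ^ N
mean-step zero    S x = ≤-trans (≤-reflexive (eq x)) (≤-trans (m≤n+m x S) (≤-reflexive (eq′ (S + x))))
  where
  eq : ∀ x → 1 * (x * 1) ≡ x
  eq = solve-∀
  eq′ : ∀ y → y ≡ y * 1 * 1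
  eq′ = solve-∀
mean-step N@(suc _) S x = *-cancelˡ-≤ N (+-cancelˡ-≤ common _ _ (subst₂ _≤_ lhs rhs (amgm N p q)))
  where open MeanStep N S x

mean-step-< : ∀ N {S x} → suc N * x ≢ S →
  suc (suc N) ^ suc (suc N) * (x * S ^ suc N) < (S + x) ^ suc (suc N) * suc N ^ suc N
mean-step-< N′ {S} {x} Nx≢S = *-cancelˡ-<⁺ N (+-cancelˡ-< common _ _ (subst₂ _<_ lhs rhs (amgm-< N′ p≢q)))
  where
  N = suc N′
  open MeanStep N S x
  eq : ∀ N S x → N * (S + x) ≡ N * S + N * x
  eq = solve-∀
  p≢q : p ≢ q
  p≢q p≡q = Nx≢S (+-cancelˡ-≡ (N * S) _ _
    (trans (sym (eq N S x)) (trans p≡q (+-comm S (N * S)))))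

-- AM-GM for a copies of x and b copies of y, cleared of denominators. The a equal copies give
-- equality; the copies of y are then appended one at a time by `mean-step`.
weighted-amgm : ∀ a b x y → x ^ a * y ^ b * (a + b) ^ (a + b) ≤ (a * x + b * y) ^ (a + b)

private
  module WeightedStep (a b x y : ℕ) where
    N = a + b
    S = a * x + b * y

    low : suc N ^ suc N * y * (x ^ a * y ^ b * N ^ N) ≤ suc N ^ suc N * y * S ^ N
    low = *-monoʳ-≤ (suc N ^ suc N * y) (weighted-amgm a b x y)

    lhs : N ^ N * (x ^ a * y ^ suc b * (a + suc b) ^ (a + suc b)) ≡ suc N ^ suc N * y * (x ^ a * y ^ b * N ^ N)
    lhs rewrite +-suc a b = eq (suc N ^ suc N) (N ^ N) (x ^ a) (y ^ b) y
      where
      eq : ∀ e g u v y → g * (u * (y * v) * e) ≡ e * y * (u * v * g)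
      eq = solve-∀

    rhs : (S + y) ^ suc N * N ^ N ≡ N ^ N * (a * x + suc b * y) ^ (a + suc b)
    rhs rewrite +-suc a b = trans (*-comm ((S + y) ^ suc N) (N ^ N)) (cong (λ z → N ^ N * z ^ suc N) (eq a b x y))
      where
      eq : ∀ a b x y → a * x + b * y + y ≡ a * x + suc b * y
      eq = solve-∀

weighted-amgm a zero x y = ≤-reflexive (begin
  x ^ a * 1 * (a + 0) ^ (a + 0) ≡⟨ cong (λ z → x ^ a * 1 * z ^ z) (+-identityʳ a) ⟩
  x ^ a * 1 * a ^ a             ≡⟨ cong (_* a ^ a) (*-identityʳ (x ^ a)) ⟩
  x ^ a * a ^ a                 ≡⟨ *-comm (x ^ a) _ ⟩
  a ^ a * x ^ a                 ≡⟨ ^-distribʳ-* a x a ⟨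
  (a * x) ^ a                   ≡⟨ cong₂ _^_ (+-identityʳ (a * x)) (+-identityʳ a) ⟨
  (a * x + 0) ^ (a + 0)         ∎)
  where open ≡-Reasoning
weighted-amgm a (suc b) x y = *-cancelˡ-≤⁺ (n^n>0 N) (subst₂ _≤_ (sym lhs) rhs
  (≤-trans low (≤-trans (≤-reflexive (*-assoc (suc N ^ suc N) y _)) (mean-step N S y))))
  where open WeightedStep a b x y

-- One strict step suffices, and the last one is strict: the mean of the copies of x and the earlier
-- copies of y differs from y, since at least one x is present.
weighted-amgm-< : ∀ a b {x y} → x ≢ y → let a = suc a; b = suc b in
  x ^ a * y ^ b * (a + b) ^ (a + b) < (a * x + b * y) ^ (a + b)
weighted-amgm-< a′ b {x} {y} x≢y = *-cancelˡ-<⁺ (N ^ N) (subst₂ _<_ (sym lhs) rhs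
  (≤-<-trans low (≤-<-trans (≤-reflexive (*-assoc (suc N ^ suc N) y _)) (mean-step-< (a′ + b) Ny≢S))))
  where
  a = suc a′
  open WeightedStep a b x y
  Ny≢S : N * y ≢ S
  Ny≢S eq = x≢y (sym (*-cancelˡ-≡⁺ {a} z<s
    (+-cancelʳ-≡ (b * y) _ _ (trans (sym (*-distribʳ-+ y a b)) eq))))

-- The log sum inequality s log (s/c) + t log (t/1) ≥ (s + t) log ((s + t)/(c + 1)).
log-sum : ∀ s t c → c ^ s * (s + t) ^ (s + t) ≤ s ^ s * t ^ t * suc c ^ (s + t)

private
  module LogSum (s t c : ℕ) where
    -- Weighted AM-GM is applied with weights s and t to the ratios c/s and 1/t, multiplied by s t
    -- to become c t and s. The factor d is what both sides then share; equality means c t = s.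
    d = (s ^ t) * (t ^ s)

    lhs : (c * t) ^ s * s ^ t * (s + t) ^ (s + t) ≡ d * (c ^ s * (s + t) ^ (s + t))
    lhs = trans (cong (λ z → z * s ^ t * (s + t) ^ (s + t)) (^-distribʳ-* c t s))
                (eq (c ^ s) (t ^ s) (s ^ t) ((s + t) ^ (s + t)))
      where
      eq : ∀ e f g h → e * f * g * h ≡ g * f * (e * h)
      eq = solve-∀

    rhs : (s * (c * t) + t * s) ^ (s + t) ≡ d * (s ^ s * t ^ t * suc c ^ (s + t))
    rhs = begin
      (s * (c * t) + t * s) ^ (s + t)                      ≡⟨ cong (_^ (s + t)) (eq s t c) ⟩
      (s * (t * suc c)) ^ (s + t)                          ≡⟨ ^-distribʳ-* s _ (s + t) ⟩
      s ^ (s + t) * (t * suc c) ^ (s + t)                  ≡⟨ cong₂ _*_ (^-distribˡ-+-* s s t) (trans (^-distribʳ-* t (suc c) (s + t)) (cong (_* suc c ^ (s + t)) (^-distribˡ-+-* t s t))) ⟩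
      s ^ s * s ^ t * (t ^ s * t ^ t * suc c ^ (s + t))    ≡⟨ eq′ (s ^ s) (s ^ t) (t ^ s) (t ^ t) (suc c ^ (s + t)) ⟩
      d * (s ^ s * t ^ t * suc c ^ (s + t))                ∎
      where
      open ≡-Reasoning
      eq : ∀ s t c → s * (c * t) + t * s ≡ s * (t * suc c)
      eq = solve-∀
      eq′ : ∀ e f g h k → e * f * (g * h * k) ≡ f * g * (e * h * k)
      eq′ = solve-∀

  log-sum-0 : ∀ s c → c ^ s * (s + 0) ^ (s + 0) ≡ s ^ s * 1 * c ^ (s + 0)
  log-sum-0 s c = trans (cong (λ z → c ^ s * z ^ z) (+-identityʳ s))
    (trans (eq (c ^ s) (s ^ s)) (cong (λ z → s ^ s * 1 * c ^ z) (sym (+-identityʳ s))))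
    where
    eq : ∀ y z → y * z ≡ z * 1 * y
    eq = solve-∀

log-sum zero t c = ≤-trans (≤-reflexive (eq (t ^ t))) (*-monoʳ-≤ (1 * t ^ t) (^-pos {suc c} t z<s))
  where
  eq : ∀ z → 1 * z ≡ 1 * z * 1
  eq = solve-∀
log-sum s@(suc _) zero c =
  ≤-trans (≤-reflexive (log-sum-0 s c)) (*-monoʳ-≤ (s ^ s * 1) (^-monoˡ-≤ (s + 0) (n≤1+n c)))
log-sum s@(suc _) t@(suc _) c = *-cancelˡ-≤⁺ (*-pos (^-pos t z<s) (^-pos s z<s))
  (subst₂ _≤_ lhs rhs (weighted-amgm s t (c * t) s))
  where open LogSum s t c

log-sum-< : ∀ s t c → c * t ≢ s → c ^ s * (s + t) ^ (s + t) < s ^ s * t ^ t * suc c ^ (s + t)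
log-sum-< zero t c ct≢0 = ≤-<-trans (≤-reflexive (eq (t ^ t))) (*-monoʳ-<⁺ (*-pos {1} z<s (n^n>0 t)) (1< c t ct≢0))
  where
  eq : ∀ z → 1 * z ≡ 1 * z * 1
  eq = solve-∀
  1< : ∀ c t → c * t ≢ 0 → 1 < suc c ^ t
  1< zero    _       0≢0 = contradiction refl 0≢0
  1< (suc c) zero    c≢0 = contradiction (*-zeroʳ c) c≢0
  1< (suc c) (suc t) _   = ^-monoʳ-< (suc (suc c)) (s<s z<s) {0} {suc t} z<s
log-sum-< s@(suc _) zero c _ =
  ≤-<-trans (≤-reflexive (log-sum-0 s c)) (*-monoʳ-<⁺ (*-pos (n^n>0 s) (z<s {0})) (^-monoˡ-< (s + 0) (n<1+n c)))
log-sum-< s@(suc s′) t@(suc t′) c ct≢s = *-cancelˡ-<⁺ d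
  (subst₂ _<_ lhs rhs (weighted-amgm-< s′ t′ ct≢s))
  where open LogSum s t c

^-swap : ∀ x a b → (x ^ a) ^ b ≡ (x ^ b) ^ a
^-swap x a b = trans (^-*-assoc x a b) (trans (cong (x ^_) (*-comm a b)) (sym (^-*-assoc x b a)))

-- Sums and products over Fin n

∑-const : ∀ n c → ∑ {n} (λ _ → c) ≡ n * c
∑-const zero    c = refl
∑-const (suc n) c = cong (c +_) (∑-const n c)

term≤∑ : (f : Fin n → ℕ) (i : Fin n) → f i ≤ ∑ f
term≤∑ f zero    = m≤m+n _ _
term≤∑ f (suc i) = ≤-trans (term≤∑ (f ∘ suc) i) (m≤n+m _ _)

∑-pos⇒term-pos : (f : Fin n → ℕ) → 0 < ∑ f → ∃ λ i → 0 < f i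
∑-pos⇒term-pos {suc n} f 0<∑ with f zero in eq
... | suc _ = zero , subst (0 <_) (sym eq) z<s
... | zero  with ∑-pos⇒term-pos (f ∘ suc) 0<∑
...   | i , 0<fi = suc i , 0<fi

∑-mono : {f g : Fin n → ℕ} → (∀ i → f i ≤ g i) → ∑ f ≤ ∑ g
∑-mono {zero}  f≤g = z≤n
∑-mono {suc n} f≤g = +-mono-≤ (f≤g zero) (∑-mono (f≤g ∘ suc))

∑-tight : {f g : Fin n → ℕ} → (∀ i → f i ≤ g i) → ∑ f ≡ ∑ g → ∀ i → f i ≡ g i
∑-tight {suc n} {f} {g} f≤g eq i = ≤-antisym (f≤g i) (+-cancelʳ-≤ (∑ (λ j → f (punchIn i j))) _ _ (begin
  g i + ∑ (λ j → f (punchIn i j)) ≤⟨ +-monoʳ-≤ (g i) (∑-mono (λ j → f≤g (punchIn i j))) ⟩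
  g i + ∑ (λ j → g (punchIn i j)) ≡⟨ sum-remove {i = i} g ⟨
  ∑ g                             ≡⟨ eq ⟨
  ∑ f                             ≡⟨ sum-remove {i = i} f ⟩
  f i + ∑ (λ j → f (punchIn i j)) ∎))
  where open ≤-Reasoning

∑-split : ∀ m {n} (f : Fin (m + n) → ℕ) → ∑ f ≡ ∑ (λ i → f (i ↑ˡ n)) + ∑ (λ j → f (m ↑ʳ j))
∑-split zero    f = refl
∑-split (suc m) f = trans (cong (f zero +_) (∑-split m (f ∘ suc))) (sym (+-assoc (f zero) _ _))

∏-const : ∀ n c → ∏ {n} (λ _ → c) ≡ c ^ n
∏-const zero    c = refl
∏-const (suc n) c = cong (c *_) (∏-const n c)

∏-^ : ∀ c (f : Fin n → ℕ) → ∏ (λ i → f i ^ c) ≡ ∏ f ^ c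
∏-^ {zero}  c f = sym (^-zeroˡ c)
∏-^ {suc n} c f = trans (cong (f zero ^ c *_) (∏-^ c (f ∘ suc))) (sym (^-distribʳ-* (f zero) _ c))

^-∑ : ∀ c (f : Fin n → ℕ) → ∏ (λ i → c ^ f i) ≡ c ^ ∑ f
^-∑ {zero}  c f = refl
^-∑ {suc n} c f = trans (cong (c ^ f zero *_) (^-∑ c (f ∘ suc))) (sym (^-distribˡ-+-* c (f zero) _))

∏-pos : {f : Fin n → ℕ} → (∀ i → 0 < f i) → 0 < ∏ f
∏-pos {zero}  0<f = z<s
∏-pos {suc n} 0<f = *-pos (0<f zero) (∏-pos (0<f ∘ suc))

∏-mono : {f g : Fin n → ℕ} → (∀ i → f i ≤ g i) → ∏ f ≤ ∏ g
∏-mono {zero}  f≤g = ≤-refl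
∏-mono {suc n} f≤g = *-mono-≤ (f≤g zero) (∏-mono (f≤g ∘ suc))

∏-tight : {f g : Fin n → ℕ} → (∀ i → 0 < f i) → (∀ i → f i ≤ g i) → ∏ f ≡ ∏ g → ∀ i → f i ≡ g i
∏-tight {suc n} {f} {g} 0<f f≤g eq i = proj₁ (*-tight (f≤g i)
  (∏-mono (λ j → f≤g (punchIn i j))) (0<f i) (∏-pos (λ j → 0<f (punchIn i j)))
  (trans (sym (∏-remove {i = i} f)) (trans eq (∏-remove {i = i} g))))

zero-or-one : ∀ {a} → a ≤ 1 → a ≡ 0 ⊎ a ≡ 1
zero-or-one z≤n       = inj₁ refl
zero-or-one (s≤s z≤n) = inj₂ refl

-- Convexity of x log x: the t k selected by a have mean S / r, and
-- S log (S / r) ≤ Σ t k log (t k).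
module _ where
  private
    S : (a t : Fin n → ℕ) → ℕ
    S a t = ∑ (λ k → a k * t k)

    X : (a t : Fin n → ℕ) → ℕ
    X a t = ∏ (λ k → t k ^ (a k * t k))

  convexity : (a t : Fin n → ℕ) → (∀ k → a k ≤ 1) → S a t ^ S a t ≤ ∑ a ^ S a t * X a t

  private
    step-eqˡ : ∀ s t c → c ^ s * (t + s) ^ (t + s) ≡ c ^ s * (s + t) ^ (s + t)
    step-eqˡ s t c = cong (λ z → c ^ s * z ^ z) (+-comm t s)

    step-eqʳ : ∀ s t c x → c ^ s * x * t ^ t * suc c ^ (s + t) ≡ c ^ s * (suc c ^ (t + s) * (t ^ t * x))
    step-eqʳ s t c x = trans (eq (c ^ s) x (t ^ t) (suc c ^ (s + t)))
      (cong (λ z → c ^ s * (suc c ^ z * (t ^ t * x))) (+-comm s t))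
      where
      eq : ∀ e x f g → e * x * f * g ≡ e * (g * (f * x))
      eq = solve-∀

    -- The induction has to cancel this power. The bad case, c = 0 with s > 0, is excluded by the
    -- convexity bound itself, which would read s ^ s ≤ 0.
    c^s>0 : (a t : Fin n → ℕ) → (∀ k → a k ≤ 1) → 0 < ∑ a ^ S a t
    c^s>0 a t a≤1 with ∑ a | S a t | convexity a t a≤1
    ... | _     | zero  | _ = z<s
    ... | suc _ | suc s | _ = ^-pos (suc s) z<s
    ... | zero  | suc s | p = contradiction (≤-trans (n^n>0 (suc s)) p) λ ()

    convexity-step : ∀ s t c x → s ^ s ≤ c ^ s * x →
      c ^ s * (t + s) ^ (t + s) ≤ c ^ s * (suc c ^ (t + s) * (t ^ t * x))
    convexity-step s t c x h = begin
      c ^ s * (t + s) ^ (t + s)               ≡⟨ step-eqˡ s t c ⟩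
      c ^ s * (s + t) ^ (s + t)               ≤⟨ log-sum s t c ⟩
      s ^ s * t ^ t * suc c ^ (s + t)         ≤⟨ *-monoˡ-≤ (suc c ^ (s + t)) (*-monoˡ-≤ (t ^ t) h) ⟩
      c ^ s * x * t ^ t * suc c ^ (s + t)     ≡⟨ step-eqʳ s t c x ⟩
      c ^ s * (suc c ^ (t + s) * (t ^ t * x)) ∎
      where open ≤-Reasoning

    convexity-step-tight : ∀ s t c x → s ^ s ≤ c ^ s * x → 0 < c ^ s →
      (t + s) ^ (t + s) ≡ suc c ^ (t + s) * (t ^ t * x) → c * t ≡ s × s ^ s ≡ c ^ s * x
    convexity-step-tight s t c x h 0<c^s eq = ct≡s , tight
      where
      lower : s ^ s * t ^ t * suc c ^ (s + t) ≤ c ^ s * (s + t) ^ (s + t)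
      lower = begin
        s ^ s * t ^ t * suc c ^ (s + t)         ≤⟨ *-monoˡ-≤ (suc c ^ (s + t)) (*-monoˡ-≤ (t ^ t) h) ⟩
        c ^ s * x * t ^ t * suc c ^ (s + t)     ≡⟨ step-eqʳ s t c x ⟩
        c ^ s * (suc c ^ (t + s) * (t ^ t * x)) ≡⟨ cong (c ^ s *_) eq ⟨
        c ^ s * (t + s) ^ (t + s)               ≡⟨ step-eqˡ s t c ⟩
        c ^ s * (s + t) ^ (s + t)               ∎
        where open ≤-Reasoning
      ct≡s : c * t ≡ s
      ct≡s with c * t ≟ s
      ... | yes p = p
      ... | no ¬p = contradiction lower (<⇒≱ (log-sum-< s t c ¬p))
      d = t ^ t * suc c ^ (s + t)
      tight : s ^ s ≡ c ^ s * x
      tight = ≤-antisym h (*-cancelˡ-≤⁺ {d} (*-pos (n^n>0 t) (^-pos {suc c} (s + t) z<s)) (begin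
        d * (c ^ s * x)                         ≡⟨ eq₁ (t ^ t) (suc c ^ (s + t)) (c ^ s * x) ⟩
        c ^ s * x * t ^ t * suc c ^ (s + t)     ≡⟨ step-eqʳ s t c x ⟩
        c ^ s * (suc c ^ (t + s) * (t ^ t * x)) ≡⟨ cong (c ^ s *_) eq ⟨
        c ^ s * (t + s) ^ (t + s)               ≡⟨ step-eqˡ s t c ⟩
        c ^ s * (s + t) ^ (s + t)               ≤⟨ log-sum s t c ⟩
        s ^ s * t ^ t * suc c ^ (s + t)         ≡⟨ eq₁ (t ^ t) (suc c ^ (s + t)) (s ^ s) ⟨
        d * s ^ s                               ∎))
        where
        open ≤-Reasoning
        eq₁ : ∀ f g y → f * g * y ≡ y * f * g
        eq₁ = solve-∀

  convexity {zero}  a t a≤1 = ≤-refl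
  convexity {suc n} a t a≤1 with a zero | a≤1 zero
  ... | zero        | _ = subst (S (a ∘ suc) (t ∘ suc) ^ S (a ∘ suc) (t ∘ suc) ≤_) (cong (∑ (a ∘ suc) ^ S (a ∘ suc) (t ∘ suc) *_) (sym (*-identityˡ _)))
                            (convexity (a ∘ suc) (t ∘ suc) (a≤1 ∘ suc))
  ... | suc zero    | _ rewrite *-identityˡ (t zero) =
      *-cancelˡ-≤⁺ (c^s>0 (a ∘ suc) (t ∘ suc) (a≤1 ∘ suc))
        (convexity-step (S (a ∘ suc) (t ∘ suc)) (t zero) (∑ (a ∘ suc)) (X (a ∘ suc) (t ∘ suc))
          (convexity (a ∘ suc) (t ∘ suc) (a≤1 ∘ suc)))
  ... | suc (suc _) | s≤s ()

  -- When the head is selected, `log-sum-<` is strict unless the head equals the mean of the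
  -- selected terms in the tail. Equality therefore passes to the tail and makes all selected terms
  -- equal to the common mean.
  convexity-tight : (a t : Fin n → ℕ) → (∀ k → a k ≤ 1) → 0 < S a t →
    S a t ^ S a t ≡ ∑ a ^ S a t * X a t → ∀ k → a k ≡ 1 → ∑ a * t k ≡ S a t
  convexity-tight {suc n} a t a≤1 0<S eq k ak≡1 with a zero in a₀ | a≤1 zero
  convexity-tight {suc n} a t a≤1 0<S eq zero ak≡1 | zero | _ = contradiction (trans (sym a₀) ak≡1) λ ()
  convexity-tight {suc n} a t a≤1 0<S eq (suc k) ak≡1 | zero | _ =
    convexity-tight (a ∘ suc) (t ∘ suc) (a≤1 ∘ suc) 0<S
      (trans eq (cong (∑ (a ∘ suc) ^ S (a ∘ suc) (t ∘ suc) *_) (*-identityˡ _))) k ak≡1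
  convexity-tight {suc n} a t a≤1 0<S eq k ak≡1 | suc zero | _
    rewrite *-identityˡ (t zero)
    with convexity-step-tight (S (a ∘ suc) (t ∘ suc)) (t zero) (∑ (a ∘ suc)) (X (a ∘ suc) (t ∘ suc))
           (convexity (a ∘ suc) (t ∘ suc) (a≤1 ∘ suc)) (c^s>0 (a ∘ suc) (t ∘ suc) (a≤1 ∘ suc)) eq
  ... | ct≡s , eq′ with k
  ...   | zero   = cong (t zero +_) ct≡s
  ...   | suc k′ = trans (cong (_+ c * t (suc k′)) (sym t₀≡)) (cong (t zero +_) ih)
    where
    c = ∑ (a ∘ suc)
    s = S (a ∘ suc) (t ∘ suc)
    0<c : 0 < c
    0<c = ≤-trans (≤-reflexive (sym ak≡1)) (term≤∑ (a ∘ suc) k′)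
    0<s : 0 < s
    0<s = n≢0⇒n>0 λ s≡0 → <⇒≢ 0<S (sym (trans (cong₂ _+_
            (*-cancelˡ-≡⁺ 0<c (trans ct≡s (trans s≡0 (sym (*-zeroʳ c))))) s≡0) refl))
    ih : c * t (suc k′) ≡ s
    ih = convexity-tight (a ∘ suc) (t ∘ suc) (a≤1 ∘ suc) 0<s eq′ k′ ak≡1
    t₀≡ : t zero ≡ t (suc k′)
    t₀≡ = *-cancelˡ-≡⁺ 0<c (trans ct≡s (sym ih))
  convexity-tight {suc n} a t a≤1 0<S eq k ak≡1 | suc (suc _) | s≤s ()

-- Permanents

-- Permutations are listed up to pointwise equality only, so a reindexed list cannot be compared
-- with the original by propositional equality. For a function respecting the equivalence,
-- duplicate-free complete lists have equal sums: entries of one are removed from the other one by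
-- one.
module Enumeration (S : Setoid 0ℓ 0ℓ) where
  open Setoid S using (_≈_) renaming (Carrier to A; sym to ≈-sym; trans to ≈-trans)
  open SetoidMembership S using (_∈_)

  module _ (f : A → ℕ) (f-cong : ∀ {x y} → x ≈ y → f x ≡ f y) where

    sum-─ : ∀ {x ys} (x∈ys : x ∈ ys) → sum (map f ys) ≡ f x + sum (map f (ys ─ x∈ys))
    sum-─ {ys = y ∷ ys} (here x≈y)    = cong (_+ sum (map f ys)) (sym (f-cong x≈y))
    sum-─ {x} {y ∷ ys}  (there x∈ys) = begin
      f y + sum (map f ys)                        ≡⟨ cong (f y +_) (sum-─ x∈ys) ⟩
      f y + (f x + sum (map f (ys ─ x∈ys)))       ≡⟨ eq (f y) (f x) _ ⟩
      f x + (f y + sum (map f (ys ─ x∈ys)))       ∎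
      where
      open ≡-Reasoning
      eq : ∀ a b c → a + (b + c) ≡ b + (a + c)
      eq = solve-∀

    ∈-─ : ∀ {x z ys} (x∈ys : x ∈ ys) → z ∈ ys → ¬ (x ≈ z) → z ∈ (ys ─ x∈ys)
    ∈-─ (here x≈y)   (here z≈y)   x≉z = contradiction (≈-trans x≈y (≈-sym z≈y)) x≉z
    ∈-─ (here x≈y)   (there z∈ys) x≉z = z∈ys
    ∈-─ (there x∈ys) (here z≈y)   x≉z = here z≈y
    ∈-─ (there x∈ys) (there z∈ys) x≉z = there (∈-─ x∈ys z∈ys x≉z)

    unique⇒sum-≤ : ∀ {xs ys} → Unique S xs → All (_∈ ys) xs → sum (map f xs) ≤ sum (map f ys)
    unique⇒sum-≤ {[]}     _          _                  = z≤n
    unique⇒sum-≤ {x ∷ xs} (x# ∷ xs!) (x∈ys All.∷ xs⊆ys) = ≤-trans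
      (+-monoʳ-≤ (f x) (unique⇒sum-≤ xs! (All.zipWith (λ (x≉z , z∈ys) → ∈-─ x∈ys z∈ys x≉z) (x# , xs⊆ys))))
      (≤-reflexive (sym (sum-─ x∈ys)))

    sum-enumerations : ∀ {xs ys} → Unique S xs → Unique S ys → IsEnumeration S xs → IsEnumeration S ys →
      sum (map f xs) ≡ sum (map f ys)
    sum-enumerations xs! ys! xs-all ys-all = ≤-antisym
      (unique⇒sum-≤ xs! (All.universal ys-all _)) (unique⇒sum-≤ ys! (All.universal xs-all _))

sum-permutations-reindex : (f : Permutation′ n → ℕ) (φ ψ : Permutation′ n → Permutation′ n) →
  (∀ {π σ} → π Perm.≈ σ → f π ≡ f σ) →
  (∀ {π σ} → π Perm.≈ σ → φ π Perm.≈ φ σ) →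
  (∀ {π σ} → π Perm.≈ σ → ψ π Perm.≈ ψ σ) →
  (∀ π → φ (ψ π) Perm.≈ π) → (∀ π → ψ (φ π) Perm.≈ π) →
  sum (map f (permutations n)) ≡ sum (map (f ∘ φ) (permutations n))
sum-permutations-reindex {n} f φ ψ f-cong φ-cong ψ-cong φψ ψφ = begin
  sum (map f (permutations n))         ≡⟨ Enumeration.sum-enumerations S f (λ {π} {σ} → f-cong {π} {σ})
    (permutations-unique n)
    (Uniqueₚ.map⁺ S S (λ {π} {σ} φπ≈φσ → ≈-trans {π} {ψ (φ π)} {σ} (≈-sym {ψ (φ π)} {π} (ψφ π))
       (≈-trans {ψ (φ π)} {ψ (φ σ)} {σ} (ψ-cong {φ π} {φ σ} φπ≈φσ) (ψφ σ))) (permutations-unique n))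
    (permutations-complete n)
    (λ π → SetoidMembershipₚ.∈-resp-≈ S {x = φ (ψ π)} {y = π} (φψ π)
      (SetoidMembershipₚ.∈-map⁺ S S (λ {π} {σ} → φ-cong {π} {σ}) (permutations-complete n (ψ π)))) ⟩
  sum (map f (map φ (permutations n))) ≡⟨ cong sum (map-∘ (permutations n)) ⟨
  sum (map (f ∘ φ) (permutations n))   ∎
  where
  open ≡-Reasoning
  S = permutationSetoid n
  open Setoid S using () renaming (sym to ≈-sym; trans to ≈-trans)

flip-cong : {π σ : Permutation′ n} → π Perm.≈ σ → flip π Perm.≈ flip σ
flip-cong {π = π} {σ} π≈σ i = begin
  π ⟨$⟩ˡ i                         ≡⟨ cong (π ⟨$⟩ˡ_) (inverseʳ σ) ⟨
  π ⟨$⟩ˡ (σ ⟨$⟩ʳ (σ ⟨$⟩ˡ i))       ≡⟨ cong (π ⟨$⟩ˡ_) (π≈σ (σ ⟨$⟩ˡ i)) ⟨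
  π ⟨$⟩ˡ (π ⟨$⟩ʳ (σ ⟨$⟩ˡ i))       ≡⟨ inverseˡ π ⟩
  σ ⟨$⟩ˡ i                         ∎
  where open ≡-Reasoning

diagonal : Matrix n → Permutation′ n → ℕ
diagonal A σ = ∏ (λ i → A i (σ ⟨$⟩ʳ i))

diagonal-cong : (A : Matrix n) {π σ : Permutation′ n} → π Perm.≈ σ → diagonal A π ≡ diagonal A σ
diagonal-cong A π≈σ = ∏-cong (λ i → cong (A i) (π≈σ i))

transpose : Matrix n → Matrix n
transpose A i j = A j i

per-transpose : (A : Matrix n) → per (transpose A) ≡ per A
per-transpose {n} A = begin
  per (transpose A)                                     ≡⟨ cong sum (map-cong diagonal-flip (permutations n)) ⟩
  sum (map (diagonal A ∘ flip) (permutations n))        ≡⟨ sum-permutations-reindex (diagonal A) flip flip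
    (λ {π} {σ} → diagonal-cong A {π} {σ}) (λ {π} {σ} → flip-cong {π = π} {σ}) (λ {π} {σ} → flip-cong {π = π} {σ}) (λ _ _ → refl) (λ _ _ → refl) ⟨
  per A                                                 ∎
  where
  open ≡-Reasoning
  diagonal-flip : ∀ σ → diagonal (transpose A) σ ≡ diagonal A (flip σ)
  diagonal-flip σ = trans (∏-permute (λ i → A (σ ⟨$⟩ʳ i) i) (flip σ))
    (∏-cong (λ i → cong (λ j → A j (σ ⟨$⟩ˡ i)) (inverseʳ σ)))

per-permute-columns : (A : Matrix n) (τ : Permutation′ n) → per (λ i j → A i (τ ⟨$⟩ʳ j)) ≡ per A
per-permute-columns A τ = sym (sum-permutations-reindex (diagonal A) (_∘ₚ τ) (_∘ₚ flip τ)
  (λ {π} {σ} → diagonal-cong A {π} {σ}) (λ π≈σ i → cong (τ ⟨$⟩ʳ_) (π≈σ i)) (λ π≈σ i → cong (τ ⟨$⟩ˡ_) (π≈σ i))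
  (λ π i → inverseʳ τ) (λ π i → inverseˡ τ))

per-permute-rows : (A : Matrix n) (τ : Permutation′ n) → per (λ i j → A (τ ⟨$⟩ʳ i) j) ≡ per A
per-permute-rows A τ = begin
  per (λ i j → A (τ ⟨$⟩ʳ i) j)           ≡⟨ per-transpose (λ i j → A (τ ⟨$⟩ʳ i) j) ⟨
  per (λ i j → transpose A i (τ ⟨$⟩ʳ j)) ≡⟨ per-permute-columns (transpose A) τ ⟩
  per (transpose A)                      ≡⟨ per-transpose A ⟩
  per A                                  ∎
  where open ≡-Reasoning

-- Laplace expansion and block matrices

minor : Matrix (suc n) → Fin (suc n) → Fin (suc n) → Matrix n
minor A i k a b = A (punchIn i a) (punchIn k b)

private
  sum-map-*ˡ : {A : Set} (c : ℕ) (f : A → ℕ) (xs : List A) → sum (map (λ x → c * f x) xs) ≡ c * sum (map f xs)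
  sum-map-*ˡ c f []       = sym (*-zeroʳ c)
  sum-map-*ˡ c f (x ∷ xs) = trans (cong (c * f x +_) (sum-map-*ˡ c f xs)) (sym (*-distribˡ-+ c (f x) _))

  sum-cartesianProductWith-tabulate : {A B C : Set} (f : C → ℕ) (g : A → B → C) (h : Fin n → A) (ys : List B) →
    sum (map f (cartesianProductWith g (tabulate h) ys)) ≡ ∑ (λ k → sum (map (f ∘ g (h k)) ys))
  sum-cartesianProductWith-tabulate {zero}  f g h ys = refl
  sum-cartesianProductWith-tabulate {suc n} f g h ys = begin
    sum (map f (map (g (h zero)) ys ++ rest))              ≡⟨ cong sum (map-++ f (map (g (h zero)) ys) rest) ⟩
    sum (map f (map (g (h zero)) ys) ++ map f rest)        ≡⟨ sum-++ (map f (map (g (h zero)) ys)) (map f rest) ⟩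
    sum (map f (map (g (h zero)) ys)) + sum (map f rest)   ≡⟨ cong₂ _+_ (cong sum (sym (map-∘ ys))) (sum-cartesianProductWith-tabulate f g (h ∘ suc) ys) ⟩
    sum (map (f ∘ g (h zero)) ys) + ∑ (λ k → sum (map (f ∘ g (h (suc k))) ys)) ∎
    where
    open ≡-Reasoning
    rest = cartesianProductWith g (tabulate (h ∘ suc)) ys

-- Top-row expansion is how `permutations (suc n)` is generated: `insert zero k π` sends the first
-- row to k and lets π act on the remaining rows and columns.
per-expand₀ : (A : Matrix (suc n)) → per A ≡ ∑ (λ k → A zero k * per (minor A zero k))
per-expand₀ {n} A = trans
  (sum-cartesianProductWith-tabulate (diagonal A) (insert zero) id (permutations n))
  (sum-cong-≗ (λ k → sum-map-*ˡ (A zero k) (diagonal (minor A zero k)) (permutations n)))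

per-expand-row : (A : Matrix (suc n)) (i : Fin (suc n)) → per A ≡ ∑ (λ k → A i k * per (minor A i k))
-- `insert zero i Perm.id` sends `zero` to i and `suc a` to `punchIn i a`, so the minors of the
-- row-permuted matrix at its top row are definitionally the minors of A at row i.
per-expand-row A i = trans (sym (per-permute-rows A (insert zero i Perm.id)))
  (per-expand₀ (λ j k → A (insert zero i Perm.id ⟨$⟩ʳ j) k))

per-expand-column : (A : Matrix (suc n)) (k : Fin (suc n)) → per A ≡ ∑ (λ i → A i k * per (minor A i k))
per-expand-column A k = begin
  per A                                                              ≡⟨ per-transpose A ⟨
  per (transpose A)                                                  ≡⟨ per-expand-row (transpose A) k ⟩
  ∑ (λ i → A i k * per (minor (transpose A) k i))                    ≡⟨ sum-cong-≗ (λ i → cong (A i k *_) (per-transpose (minor A i k))) ⟩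
  ∑ (λ i → A i k * per (minor A i k))                                ∎
  where open ≡-Reasoning

-- Induction on the size of the first block along the top row: columns of the second block
-- contribute 0. Indexing by sums makes the other minors block matrices again, with `Sum.map₁`
-- relabelling the first part.
per-block : ∀ a {b} (M : Fin a ⊎ Fin b → Fin a ⊎ Fin b → ℕ) → (∀ i j → M (inj₁ i) (inj₂ j) ≡ 0) →
  per (λ u v → M (splitAt a u) (splitAt a v)) ≡
  per (λ i j → M (inj₁ i) (inj₁ j)) * per (λ i j → M (inj₂ i) (inj₂ j))
per-block zero    M M₁₂≡0 = sym (*-identityˡ _)
per-block (suc a) {b} M M₁₂≡0 = begin
  per A                                                       ≡⟨ per-expand₀ A ⟩
  ∑ (λ k → A zero k * per (minor A zero k))                   ≡⟨ ∑-split (suc a) {b} (λ k → A zero k * per (minor A zero k)) ⟩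
  ∑ (λ k → A zero (k ↑ˡ b) * per (minor A zero (k ↑ˡ b))) +
  ∑ (λ k → A zero (suc a ↑ʳ k) * per (minor A zero (suc a ↑ʳ k))) ≡⟨ cong₂ _+_ (sum-cong-≗ left) (trans (sum-cong-≗ right) (trans (∑-const b 0) (*-zeroʳ b))) ⟩
  ∑ (λ k → M₁ zero k * per (minor M₁ zero k) * per M₂) + 0    ≡⟨ +-identityʳ _ ⟩
  ∑ (λ k → M₁ zero k * per (minor M₁ zero k) * per M₂)        ≡⟨ *-distribʳ-sum (per M₂) (λ k → M₁ zero k * per (minor M₁ zero k)) ⟨
  ∑ (λ k → M₁ zero k * per (minor M₁ zero k)) * per M₂        ≡⟨ cong (_* per M₂) (per-expand₀ M₁) ⟨
  per M₁ * per M₂                                             ∎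
  where
  open ≡-Reasoning
  A = λ u v → M (splitAt (suc a) u) (splitAt (suc a) v)
  M₁ : Matrix (suc a)
  M₁ i j = M (inj₁ i) (inj₁ j)
  M₂ : Matrix b
  M₂ i j = M (inj₂ i) (inj₂ j)

  splitAt-punchIn : ∀ a (k : Fin (suc a)) (v : Fin (a + b)) →
    splitAt (suc a) (punchIn (k ↑ˡ b) v) ≡ Sum.map₁ (punchIn k) (splitAt a v)
  splitAt-punchIn a       zero    v       with splitAt a v
  ... | inj₁ _ = refl
  ... | inj₂ _ = refl
  splitAt-punchIn (suc a) (suc k) zero    = refl
  splitAt-punchIn (suc a) (suc k) (suc v) = trans (cong (Sum.map₁ suc) (splitAt-punchIn a k v)) (eq (splitAt a v))
    where
    eq : ∀ s → Sum.map₁ suc (Sum.map₁ (punchIn k) s) ≡ Sum.map₁ (punchIn (suc k)) (Sum.map₁ suc s)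
    eq (inj₁ _) = refl
    eq (inj₂ _) = refl

  left : ∀ k → A zero (k ↑ˡ b) * per (minor A zero (k ↑ˡ b)) ≡ M₁ zero k * per (minor M₁ zero k) * per M₂
  left k = begin
    A zero (k ↑ˡ b) * per (minor A zero (k ↑ˡ b)) ≡⟨ cong₂ _*_ (cong (M (inj₁ zero)) (Fin.splitAt-↑ˡ (suc a) k b))
      (per-cong (λ u v → cong (M (splitAt (suc a) (suc u))) (splitAt-punchIn a k v))) ⟩
    M₁ zero k * per (λ u v → M (Sum.map₁ suc (splitAt a u)) (Sum.map₁ (punchIn k) (splitAt a v)))
      ≡⟨ cong (M₁ zero k *_) (per-block a (λ s t → M (Sum.map₁ suc s) (Sum.map₁ (punchIn k) t)) (λ i j → M₁₂≡0 (suc i) j)) ⟩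
    M₁ zero k * (per (minor M₁ zero k) * per M₂)  ≡⟨ *-assoc (M₁ zero k) _ _ ⟨
    M₁ zero k * per (minor M₁ zero k) * per M₂    ∎

  right : ∀ k → A zero (suc a ↑ʳ k) * per (minor A zero (suc a ↑ʳ k)) ≡ 0
  right k = cong (_* per (minor A zero (suc a ↑ʳ k)))
    (trans (cong (M (inj₁ zero)) (Fin.splitAt-↑ʳ (suc a) b k)) (M₁₂≡0 zero k))

per-ones : ∀ n → per {n} (λ _ _ → 1) ≡ n !
per-ones zero    = refl
per-ones (suc n) = begin
  per {suc n} (λ _ _ → 1)                ≡⟨ per-expand₀ {n} (λ _ _ → 1) ⟩
  ∑ {suc n} (λ _ → 1 * per {n} (λ _ _ → 1)) ≡⟨ ∑-const (suc n) _ ⟩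
  suc n * (1 * per {n} (λ _ _ → 1))      ≡⟨ cong (suc n *_) (trans (*-identityˡ _) (per-ones n)) ⟩
  suc n * n !                            ∎
  where open ≡-Reasoning

-- Row sums of (0,1)-matrices

Binary : Matrix n → Set
Binary A = ∀ i j → A i j ≤ 1

rowSum : Matrix n → Fin n → ℕ
rowSum A i = ∑ (A i)

rowSum≤ : (A : Matrix n) → Binary A → ∀ i → rowSum A i ≤ n
rowSum≤ {n} A A≤1 i = ≤-trans (∑-mono (A≤1 i)) (≤-reflexive (trans (∑-const n 1) (*-identityʳ n)))

rowSum-minor : (A : Matrix (suc n)) (i k : Fin (suc n)) (j : Fin n) →
  rowSum (minor A i k) j ≡ rowSum A (punchIn i j) ∸ A (punchIn i j) k
rowSum-minor A i k j = sym (trans (cong (_∸ A (punchIn i j) k) (sum-remove {i = k} (A (punchIn i j))))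
  (m+n∸m≡n (A (punchIn i j) k) _))

per-pos⇒rowSum-pos : (A : Matrix n) → 0 < per A → ∀ i → 0 < rowSum A i
per-pos⇒rowSum-pos {suc n} A 0<p i
  with k , 0<w ← ∑-pos⇒term-pos (λ k → A i k * per (minor A i k)) (subst (0 <_) (per-expand-row A i) 0<p)
  = ≤-trans (*-posˡ (A i k) 0<w) (term≤∑ (A i) k)

-- Bregman's bound and its equality case

-- Two rows, or two columns, may be deleted in either order; this identifies the double minors
-- compared in the equality case.
punchIn-comm : (i j : Fin (suc (suc n))) (i≢j : i ≢ j) (j≢i : j ≢ i) (a : Fin n) →
  punchIn i (punchIn (punchOut i≢j) a) ≡ punchIn j (punchIn (punchOut j≢i) a)
punchIn-comm zero    zero    i≢j j≢i a       = contradiction refl i≢j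
punchIn-comm zero    (suc j) i≢j j≢i a       = refl
punchIn-comm (suc i) zero    i≢j j≢i a       = refl
punchIn-comm (suc i) (suc j) i≢j j≢i zero    = refl
punchIn-comm (suc i) (suc j) i≢j j≢i (suc a) = cong suc (punchIn-comm i j (i≢j ∘ cong suc) (j≢i ∘ cong suc) a)

-- What remains of G a * G (2 + a) ≤ G (1 + a) ^ 2, where G a ^ a = (a !) ^ L,
-- once the roots are cleared and the common factors cancelled.
!-inequality : ∀ a → (a !) ^ 2 * (2 + a) ^ (a * suc a) ≤ suc a ^ (a * (3 + a))
!-inequality-< : ∀ a → let b = suc a in (b !) ^ 2 * (2 + b) ^ (b * suc b) < suc b ^ (b * (3 + b))
!-inequality zero    = ≤-refl
!-inequality (suc a) = <⇒≤ (!-inequality-< a)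
!-inequality-< a = *-cancelˡ-<⁺ (suc b ^ (a * b)) (begin-strict
  suc b ^ (a * b) * ((b !) ^ 2 * (2 + b) ^ e)                     ≡⟨ cong (λ z → suc b ^ (a * b) * (z * (2 + b) ^ e)) (^-distribʳ-* b (a !) 2) ⟩
  suc b ^ (a * b) * (b ^ 2 * (a !) ^ 2 * (2 + b) ^ e)             ≡⟨ eq₁ (suc b ^ (a * b)) (b ^ 2) ((a !) ^ 2) ((2 + b) ^ e) ⟩
  b ^ 2 * (2 + b) ^ e * ((a !) ^ 2 * suc b ^ (a * b))             ≤⟨ *-monoʳ-≤ (b ^ 2 * (2 + b) ^ e) (!-inequality a) ⟩
  b ^ 2 * (2 + b) ^ e * b ^ (a * (3 + a))                         ≡⟨ eq₂ (b ^ 2) ((2 + b) ^ e) (b ^ (a * (3 + a))) ⟩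
  b ^ 2 * b ^ (a * (3 + a)) * (2 + b) ^ e                         ≡⟨ cong (_* (2 + b) ^ e) (^-distribˡ-+-* b 2 (a * (3 + a))) ⟨
  b ^ (2 + a * (3 + a)) * (2 + b) ^ e                             ≡⟨ cong (λ z → b ^ z * (2 + b) ^ e) (eq₃ a) ⟩
  b ^ e * (2 + b) ^ e                                             ≡⟨ ^-distribʳ-* b (2 + b) e ⟨
  -- The exponents of b and 2 + b have become equal, and the whole step rests on b (2 + b) < (1 +
  -- b)².
  (b * (2 + b)) ^ e                                               <⟨ ^-monoˡ-< e (≤-reflexive (eq₄ b)) ⟩
  (suc b * suc b) ^ e                                             ≡⟨ ^-distribʳ-* (suc b) (suc b) e ⟩
  suc b ^ e * suc b ^ e                                           ≡⟨ ^-distribˡ-+-* (suc b) e e ⟨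
  suc b ^ (e + e)                                                 ≡⟨ cong (suc b ^_) (eq₅ a) ⟩
  suc b ^ (a * b + b * (3 + b))                                   ≡⟨ ^-distribˡ-+-* (suc b) (a * b) (b * (3 + b)) ⟩
  suc b ^ (a * b) * suc b ^ (b * (3 + b))                         ∎)
  where
  open ≤-Reasoning
  b = suc a
  e = b * suc b
  eq₁ : ∀ x y z w → x * (y * z * w) ≡ y * w * (z * x)
  eq₁ = solve-∀
  eq₂ : ∀ x y z → x * y * z ≡ x * z * y
  eq₂ = solve-∀
  eq₃ : ∀ a → 2 + a * (3 + a) ≡ suc a * suc (suc a)
  eq₃ = solve-∀
  eq₄ : ∀ b → suc (b * (2 + b)) ≡ suc b * suc b
  eq₄ = solve-∀
  eq₅ : ∀ a → suc a * suc (suc a) + suc a * suc (suc a) ≡ a * suc a + suc a * (3 + suc a)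
  eq₅ = solve-∀

-- The exponents are b c d divided by b, d and c: this is `G b * G d < G c * G c` raised to the
-- power b c d, without the common exponent L.
!-log-concave : ∀ a → let b = suc a; c = suc b; d = suc c in
  (b !) ^ (c * d) * (d !) ^ (b * c) < (c !) ^ (b * d) * (c !) ^ (b * d)
!-log-concave a = begin-strict
  f ^ (c * d) * (d * (c * f)) ^ (b * c)                  ≡⟨ cong (f ^ (c * d) *_) (trans (^-distribʳ-* d (c * f) (b * c)) (cong (d ^ (b * c) *_) (^-distribʳ-* c f (b * c)))) ⟩
  f ^ (c * d) * (d ^ (b * c) * (c ^ (b * c) * f ^ (b * c))) ≡⟨ eq₁ (f ^ (c * d)) (d ^ (b * c)) (c ^ (b * c)) (f ^ (b * c)) ⟩
  f ^ (c * d) * f ^ (b * c) * c ^ (b * c) * d ^ (b * c)  ≡⟨ cong (λ z → z * c ^ (b * c) * d ^ (b * c)) (f^-split) ⟩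
  f ^ (e + e) * f ^ 2 * c ^ (b * c) * d ^ (b * c)        ≡⟨ eq₂ (f ^ (e + e)) (f ^ 2) (c ^ (b * c)) (d ^ (b * c)) ⟩
  f ^ (e + e) * c ^ (b * c) * (f ^ 2 * d ^ (b * c))      <⟨ *-monoʳ-<⁺ (*-pos (^-pos (e + e) (n≢0⇒n>0 (≢-nonZero⁻¹ f {{b !≢0}}))) (^-pos {c} (b * c) z<s)) (!-inequality-< a) ⟩
  f ^ (e + e) * c ^ (b * c) * c ^ (b * (3 + b))          ≡⟨ *-assoc (f ^ (e + e)) _ _ ⟩
  f ^ (e + e) * (c ^ (b * c) * c ^ (b * (3 + b)))        ≡⟨ cong (f ^ (e + e) *_) (trans (sym (^-distribˡ-+-* c (b * c) (b * (3 + b)))) (cong (c ^_) (eq₃ b))) ⟩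
  f ^ (e + e) * c ^ (e + e)                              ≡⟨ *-comm (f ^ (e + e)) _ ⟩
  c ^ (e + e) * f ^ (e + e)                              ≡⟨ ^-distribʳ-* c f (e + e) ⟨
  (c * f) ^ (e + e)                                      ≡⟨ ^-distribˡ-+-* (c * f) e e ⟩
  (c * f) ^ e * (c * f) ^ e                              ∎
  where
  open ≤-Reasoning
  b = suc a
  c = suc b
  d = suc c
  e = b * d
  f = b !
  eq₁ : ∀ x y z w → x * (y * (z * w)) ≡ x * w * z * y
  eq₁ = solve-∀
  eq₂ : ∀ x y z w → x * y * z * w ≡ x * z * (y * w)
  eq₂ = solve-∀
  eq₃ : ∀ b → b * suc b + b * (3 + b) ≡ b * suc (suc b) + b * suc (suc b)
  eq₃ = solve-∀
  eq₄ : ∀ b → suc b * suc (suc b) + b * suc b ≡ b * suc (suc b) + b * suc (suc b) + 2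
  eq₄ = solve-∀
  f^-split : f ^ (c * d) * f ^ (b * c) ≡ f ^ (e + e) * f ^ 2
  f^-split = trans (sym (^-distribˡ-+-* f (c * d) (b * c))) (trans (cong (f ^_) (eq₄ b)) (^-distribˡ-+-* f (e + e) 2))

-- G r stands for (r!)^(L/r).
module Bregman (N L : ℕ) .{{_ : NonZero L}} (G : ℕ → ℕ) (0<G : ∀ r → 0 < G r)
  (G-power : ∀ {r} → r ≤ N → G r ^ r ≡ (r !) ^ L) where

  bound : Matrix n → ℕ
  bound A = ∏ (G ∘ rowSum A)

  Tight : Matrix n → Set
  Tight A = per A ^ L ≡ bound A

  private
    G-reduce : ∀ {r a} → a ≤ 1 → G (r ∸ a) * G r ^ a ≡ G (r ∸ 1) ^ a * G r
    G-reduce {r} a≤1 with zero-or-one a≤1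
    ... | inj₁ refl = eq (G r)
      where
      eq : ∀ x → x * 1 ≡ 1 * x
      eq = solve-∀
    ... | inj₂ refl = eq (G (r ∸ 1)) (G r)
      where
      eq : ∀ x y → x * (y * 1) ≡ x * 1 * y
      eq = solve-∀

    -- With r ones in the row, the product is G(r - 1)^r G(r)^(n - r), and r^L G(r - 1)^(r - 1) =
    -- G(r)^r supplies the missing factors. Multiplying by G(r - 1)^(r - 1) first avoids the
    -- subtraction n - r.
    row-factor : (a : Fin n → ℕ) → (∀ k → a k ≤ 1) → 0 < ∑ a → ∑ a ≤ N →
      ∑ a ^ L * ∏ (λ k → G (∑ a ∸ a k)) ≡ G (∑ a ∸ 1) * G (∑ a) ^ n
    row-factor {n} a a≤1 0<r r≤N = go (∑ a) refl 0<r r≤N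
      where
      open ≡-Reasoning
      go : ∀ r → ∑ a ≡ r → 0 < r → r ≤ N → r ^ L * ∏ (λ k → G (r ∸ a k)) ≡ G (r ∸ 1) * G r ^ n
      go (suc s) ∑a≡r _ r≤N = *-cancelˡ-≡⁺ (^-pos s (0<G s)) (begin
        G s ^ s * (r ^ L * D)        ≡⟨ eq₁ (G s ^ s) (r ^ L) D ⟩
        r ^ L * G s ^ s * D          ≡⟨ cong (λ z → r ^ L * z * D) (G-power (≤-trans (n≤1+n s) r≤N)) ⟩
        r ^ L * (s !) ^ L * D        ≡⟨ cong (_* D) (^-distribʳ-* r (s !) L) ⟨
        (r !) ^ L * D                ≡⟨ cong (_* D) (G-power r≤N) ⟨
        G r ^ r * D                  ≡⟨ *-comm (G r ^ r) D ⟩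
        D * G r ^ r                  ≡⟨ cong (λ z → D * G r ^ z) ∑a≡r ⟨
        D * G r ^ ∑ a                ≡⟨ cong (D *_) (^-∑ (G r) a) ⟨
        D * ∏ (λ k → G r ^ a k)      ≡⟨ ∏-distrib-* (λ k → G (r ∸ a k)) (λ k → G r ^ a k) ⟨
        ∏ (λ k → G (r ∸ a k) * G r ^ a k) ≡⟨ ∏-cong (λ k → G-reduce {r} (a≤1 k)) ⟩
        ∏ (λ k → G s ^ a k * G r)    ≡⟨ ∏-distrib-* (λ k → G s ^ a k) (λ _ → G r) ⟩
        ∏ (λ k → G s ^ a k) * ∏ {n} (λ _ → G r) ≡⟨ cong₂ _*_ (trans (^-∑ (G s) a) (cong (G s ^_) ∑a≡r)) (∏-const n (G r)) ⟩
        G s * G s ^ s * G r ^ n      ≡⟨ eq₂ (G s) (G s ^ s) (G r ^ n) ⟩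
        G s ^ s * (G s * G r ^ n)    ∎)
        where
        r = suc s
        D = ∏ (λ k → G (r ∸ a k))
        eq₁ : ∀ x y z → x * (y * z) ≡ y * x * z
        eq₁ = solve-∀
        eq₂ : ∀ x y z → x * y * z ≡ y * (x * z)
        eq₂ = solve-∀

    -- Each row gives p^p, raised to L, a bound in two stages: `u ≤ v` by convexity and `v ≤ z` by
    -- induction on the minors. The bounds `z i` simplify only after multiplication over i; equality
    -- of the products then forces equality in every row and at both stages.
    module Step (A : Matrix (suc n)) (A≤1 : Binary A) (n<N : suc n ≤ N)
      (ih : ∀ i k → per (minor A i k) ^ L ≤ bound (minor A i k)) (0<p : 0 < per A) where

      p = per A
      r = rowSum A
      P Q w : Fin (suc n) → Fin (suc n) → ℕ
      P i k = per (minor A i k)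
      Q i k = bound (minor A i k)
      -- Every row and every column of w sums to p.
      w i k = A i k * P i k

      -- `R j k` is the factor of row j once column k is deleted. `D k` also includes the row i that
      -- a minor omits, so that it depends on k alone.
      R : Fin (suc n) → Fin (suc n) → ℕ
      R j k = G (r j ∸ A j k)
      D : Fin (suc n) → ℕ
      D k = ∏ (λ j → R j k)

      u v z : Fin (suc n) → ℕ
      u i = (p ^ p) ^ L
      v i = (r i ^ p * ∏ (λ k → P i k ^ w i k)) ^ L
      z i = (r i ^ L) ^ p * ∏ (λ k → Q i k ^ w i k)

      p-row : ∀ i → p ≡ ∑ (w i)
      p-row = per-expand-row A

      0<r : ∀ i → 0 < r i
      0<r = per-pos⇒rowSum-pos A 0<p

      0<u : ∀ i → 0 < u i
      0<u i = ^-pos L (n^n>0 p)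

      row-convexity : ∀ i → p ^ p ≤ r i ^ p * ∏ (λ k → P i k ^ w i k)
      row-convexity i = subst (λ s → s ^ s ≤ r i ^ s * ∏ (λ k → P i k ^ w i k)) (sym (p-row i))
        (convexity (A i) (P i) (A≤1 i))

      u≤v : ∀ i → u i ≤ v i
      u≤v i = ^-monoˡ-≤ L (row-convexity i)

      v-expand : ∀ i → v i ≡ (r i ^ L) ^ p * ∏ (λ k → (P i k ^ L) ^ w i k)
      v-expand i = trans (^-distribʳ-* (r i ^ p) _ L) (cong₂ _*_ (^-swap (r i) p L)
        (trans (sym (∏-^ L (λ k → P i k ^ w i k))) (∏-cong (λ k → ^-swap (P i k) (w i k) L))))

      v≤z : ∀ i → v i ≤ z i
      v≤z i = ≤-trans (≤-reflexive (v-expand i))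
        (*-monoʳ-≤ ((r i ^ L) ^ p) (∏-mono (λ k → ^-monoˡ-≤ (w i k) (ih i k))))

      Q*R : ∀ i k → R i k * Q i k ≡ D k
      Q*R i k = trans (cong (R i k *_) (∏-cong (λ j → cong G (rowSum-minor A i k j))))
        (sym (∏-remove {i = i} (λ j → R j k)))

      -- Where `A i k` is 0 the exponent is 0 and the base is immaterial; where it is 1, deleting
      -- column k lowers the row sum by one.
      R^w : ∀ i k → R i k ^ w i k ≡ G (r i ∸ 1) ^ w i k
      R^w i k with A i k | zero-or-one (A≤1 i k)
      ... | _ | inj₁ refl = refl
      ... | _ | inj₂ refl = refl

      ∏R^w : ∀ i → ∏ (λ k → R i k ^ w i k) ≡ G (r i ∸ 1) ^ p
      ∏R^w i = trans (∏-cong (R^w i)) (trans (^-∑ (G (r i ∸ 1)) (w i)) (cong (G (r i ∸ 1) ^_) (sym (p-row i))))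

      z-expand : ∀ i → G (r i ∸ 1) ^ p * z i ≡ (r i ^ L) ^ p * ∏ (λ k → D k ^ w i k)
      z-expand i = begin
        G (r i ∸ 1) ^ p * z i                                            ≡⟨ eq (G (r i ∸ 1) ^ p) ((r i ^ L) ^ p) (∏ (λ k → Q i k ^ w i k)) ⟩
        (r i ^ L) ^ p * (G (r i ∸ 1) ^ p * ∏ (λ k → Q i k ^ w i k))      ≡⟨ cong (λ x → (r i ^ L) ^ p * (x * ∏ (λ k → Q i k ^ w i k))) (∏R^w i) ⟨
        (r i ^ L) ^ p * (∏ (λ k → R i k ^ w i k) * ∏ (λ k → Q i k ^ w i k)) ≡⟨ cong ((r i ^ L) ^ p *_) (∏-distrib-* (λ k → R i k ^ w i k) (λ k → Q i k ^ w i k)) ⟨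
        (r i ^ L) ^ p * ∏ (λ k → R i k ^ w i k * Q i k ^ w i k)          ≡⟨ cong ((r i ^ L) ^ p *_) (∏-cong (λ k → trans (sym (^-distribʳ-* (R i k) (Q i k) (w i k))) (cong (_^ w i k) (Q*R i k)))) ⟩
        (r i ^ L) ^ p * ∏ (λ k → D k ^ w i k)                            ∎
        where
        open ≡-Reasoning
        eq : ∀ a b c → a * (b * c) ≡ b * (a * c)
        eq = solve-∀

      -- For fixed k the exponents `w i k` sum to p by expansion along column k. The second exchange
      -- regroups the factors by rows, as `row-factor` requires.
      ∏D^w : ∏ (λ i → ∏ (λ k → D k ^ w i k)) ≡ ∏ (λ j → ∏ (R j)) ^ p
      ∏D^w = begin
        ∏ (λ i → ∏ (λ k → D k ^ w i k))    ≡⟨ ∏-comm (λ i k → D k ^ w i k) ⟩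
        ∏ (λ k → ∏ (λ i → D k ^ w i k))    ≡⟨ ∏-cong (λ k → trans (^-∑ (D k) (λ i → w i k)) (cong (D k ^_) (sym (per-expand-column A k)))) ⟩
        ∏ (λ k → D k ^ p)                  ≡⟨ ∏-^ p D ⟩
        ∏ D ^ p                            ≡⟨ cong (_^ p) (∏-comm (λ k j → R j k)) ⟩
        ∏ (λ j → ∏ (R j)) ^ p              ∎
        where open ≡-Reasoning

      Z = ∏ (λ i → G (r i ∸ 1))

      ∏z : ∏ z ≡ (bound A ^ suc n) ^ p
      ∏z = *-cancelˡ-≡⁺ (^-pos p (∏-pos (λ i → 0<G (r i ∸ 1)))) (begin
        Z ^ p * ∏ z                                        ≡⟨ cong (_* ∏ z) (∏-^ p (λ i → G (r i ∸ 1))) ⟨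
        ∏ (λ i → G (r i ∸ 1) ^ p) * ∏ z                    ≡⟨ ∏-distrib-* (λ i → G (r i ∸ 1) ^ p) z ⟨
        ∏ (λ i → G (r i ∸ 1) ^ p * z i)                    ≡⟨ ∏-cong z-expand ⟩
        ∏ (λ i → (r i ^ L) ^ p * ∏ (λ k → D k ^ w i k))    ≡⟨ ∏-distrib-* (λ i → (r i ^ L) ^ p) (λ i → ∏ (λ k → D k ^ w i k)) ⟩
        ∏ (λ i → (r i ^ L) ^ p) * ∏ (λ i → ∏ (λ k → D k ^ w i k)) ≡⟨ cong₂ _*_ (∏-^ p (λ i → r i ^ L)) ∏D^w ⟩
        ∏ (λ i → r i ^ L) ^ p * ∏ (λ j → ∏ (R j)) ^ p      ≡⟨ ^-distribʳ-* (∏ (λ i → r i ^ L)) (∏ (λ j → ∏ (R j))) p ⟨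
        (∏ (λ i → r i ^ L) * ∏ (λ j → ∏ (R j))) ^ p        ≡⟨ cong (_^ p) (∏-distrib-* (λ i → r i ^ L) (λ j → ∏ (R j))) ⟨
        ∏ (λ i → r i ^ L * ∏ (R i)) ^ p                    ≡⟨ cong (_^ p) (∏-cong (λ i → row-factor (A i) (A≤1 i) (0<r i) (≤-trans (rowSum≤ A A≤1 i) n<N))) ⟩
        ∏ (λ i → G (r i ∸ 1) * G (r i) ^ suc n) ^ p        ≡⟨ cong (_^ p) (∏-distrib-* (λ i → G (r i ∸ 1)) (λ i → G (r i) ^ suc n)) ⟩
        (Z * ∏ (λ i → G (r i) ^ suc n)) ^ p                ≡⟨ cong (λ x → (Z * x) ^ p) (∏-^ (suc n) (G ∘ r)) ⟩
        (Z * bound A ^ suc n) ^ p                          ≡⟨ ^-distribʳ-* Z (bound A ^ suc n) p ⟩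
        Z ^ p * (bound A ^ suc n) ^ p                      ∎)
        where open ≡-Reasoning

      ∏u : ∏ u ≡ ((p ^ L) ^ suc n) ^ p
      ∏u = trans (∏-const (suc n) ((p ^ p) ^ L)) (trans (cong (_^ suc n) (^-swap p p L)) (^-swap (p ^ L) p (suc n)))

      step : p ^ L ≤ bound A
      step = ^-cancelʳ-≤ (suc n) (^-cancelʳ-≤ p {{>-nonZero 0<p}}
        (subst₂ _≤_ ∏u ∏z (∏-mono (λ i → ≤-trans (u≤v i) (v≤z i)))))

      module _ (tight : Tight A) where
        u≡z : ∀ i → u i ≡ z i
        u≡z = ∏-tight 0<u (λ i → ≤-trans (u≤v i) (v≤z i))
          (trans ∏u (trans (cong (λ x → (x ^ suc n) ^ p) tight) (sym ∏z)))

        u≡v : ∀ i → u i ≡ v i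
        u≡v i = ≤-antisym (u≤v i) (≤-trans (v≤z i) (≤-reflexive (sym (u≡z i))))

        step-tight₁ : ∀ i k → A i k ≡ 1 → r i * P i k ≡ p
        step-tight₁ i k Aik≡1 = trans (convexity-tight (A i) (P i) (A≤1 i) (subst (0 <_) (p-row i) 0<p)
          (subst (λ s → s ^ s ≡ r i ^ s * ∏ (λ k → P i k ^ w i k)) (p-row i) (^-cancelʳ-≡ L (u≡v i))) k Aik≡1)
          (sym (p-row i))

        -- Equality `v ≡ z` splits into one equality for each k. The exponent `w i k` can be
        -- cancelled where the entry is 1, because `step-tight₁` makes that minor's permanent
        -- positive.
        step-tight₂ : ∀ i k → A i k ≡ 1 → Tight (minor A i k)
        step-tight₂ i k Aik≡1 = ^-cancelʳ-≡ (w i k) {{>-nonZero 0<w}}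
          (∏-tight (λ k → 0<P^L^w k) (λ k → ^-monoˡ-≤ (w i k) (ih i k))
            (*-cancelˡ-≡⁺ (^-pos p (^-pos L (0<r i))) (trans (sym (v-expand i)) (trans (sym (u≡v i)) (u≡z i)))) k)
          where
          0<P : 0 < P i k
          0<P = *-posʳ (r i) (subst (0 <_) (sym (step-tight₁ i k Aik≡1)) 0<p)
          0<w : 0 < w i k
          0<w = subst (λ a → 0 < a * P i k) (sym Aik≡1) (≤-trans 0<P (≤-reflexive (sym (*-identityˡ _))))
          0<P^L^w : ∀ k → 0 < (P i k ^ L) ^ w i k
          0<P^L^w k with zero-or-one (A≤1 i k)
          ... | inj₁ a≡0 rewrite a≡0 = z<s
          ... | inj₂ a≡1 = ^-pos (w i k) (^-pos L (*-posʳ (r i) (subst (0 <_) (sym (step-tight₁ i k a≡1)) 0<p)))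

  bregman : n ≤ N → (A : Matrix n) → Binary A → per A ^ L ≤ bound A
  bregman {zero}  _   A _   = ≤-reflexive (^-zeroˡ L)
  bregman {suc n} n<N A A≤1 with per A in eq
  -- The step cancels the exponent p, so p = 0 is treated apart; here the left side is 0.
  ... | zero  = ≤-trans (≤-reflexive (0^L L)) z≤n
    where
    0^L : ∀ L .{{_ : NonZero L}} → 0 ^ L ≡ 0
    0^L (suc _) = refl
  ... | suc _ = subst (λ p → p ^ L ≤ bound A) eq
    (Step.step A A≤1 n<N (λ i k → bregman (≤-trans (n≤1+n n) n<N) (minor A i k) (λ _ _ → A≤1 _ _)) (subst (0 <_) (sym eq) z<s))

  module _ (n<N : suc n ≤ N) (A : Matrix (suc n)) (A≤1 : Binary A) (0<p : 0 < per A) (tight : Tight A)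
    {i k : Fin (suc n)} (Aik≡1 : A i k ≡ 1) where

    private
      ih : ∀ i k → per (minor A i k) ^ L ≤ bound (minor A i k)
      ih i k = bregman (≤-trans (n≤1+n n) n<N) (minor A i k) (λ _ _ → A≤1 _ _)

    tight⇒per-minor : rowSum A i * per (minor A i k) ≡ per A
    tight⇒per-minor = Step.step-tight₁ A A≤1 n<N ih 0<p tight i k Aik≡1

    tight-minor : Tight (minor A i k)
    tight-minor = Step.step-tight₂ A A≤1 n<N ih 0<p tight i k Aik≡1

  -- The permanent of A without the rows i, j and the columns c, d is computed
  -- by deleting (i , c) first and by deleting (j , d) first.
  tight⇒shared-column⇒⊆ : n ≤ N → (A : Matrix n) → Binary A → 0 < per A → Tight A →
    ∀ {i j c d} → A i c ≡ 1 → A j c ≡ 1 → A j d ≡ 1 → A i d ≡ 1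
  tight⇒shared-column⇒⊆ n≤N A A≤1 0<p tight {i} {j} {c} {d} Aic Ajc Ajd with zero-or-one (A≤1 i d)
  ... | inj₂ Aid = Aid
  ... | inj₁ Aid = ⊥-elim (go n≤N A A≤1 0<p tight Aic Ajc Ajd Aid)
    where
    go : ∀ {n} → n ≤ N → (A : Matrix n) → Binary A → 0 < per A → Tight A →
      ∀ {i j c d} → A i c ≡ 1 → A j c ≡ 1 → A j d ≡ 1 → A i d ≡ 0 → ⊥
    go {suc zero} _ A _ _ _ {zero} {zero} {zero} {zero} Aic _ _ Aid = contradiction (trans (sym Aic) Aid) λ ()
    go {suc n@(suc _)} n<N A A≤1 0<p tight {i} {j} {c} {d} Aic Ajc Ajd Aid =
      -- The permanent would be both rᵢ (rⱼ - 1) X and rⱼ rᵢ X. Deleting (i, c) costs row j its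
      -- entry in column c, whereas deleting (j, d) costs row i nothing, its entry in column d being
      -- 0.
      contradiction p≡ (<⇒≢ (*-monoʳ-<⁺ {rᵢ * X} (*-pos 0<rᵢ 0<X) (≤-reflexive (m+[n∸m]≡n 0<rⱼ))))
      where
      i≢j : i ≢ j
      i≢j refl = contradiction (trans (sym Ajd) Aid) λ ()
      c≢d : c ≢ d
      c≢d refl = contradiction (trans (sym Aic) Aid) λ ()
      j′ = punchOut i≢j
      d′ = punchOut c≢d
      i′ = punchOut (i≢j ∘ sym)
      c′ = punchOut (c≢d ∘ sym)
      j≡ : punchIn i j′ ≡ j
      j≡ = Fin.punchIn-punchOut i≢j
      d≡ : punchIn c d′ ≡ d
      d≡ = Fin.punchIn-punchOut c≢d
      i≡ : punchIn j i′ ≡ i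
      i≡ = Fin.punchIn-punchOut (i≢j ∘ sym)
      c≡ : punchIn d c′ ≡ c
      c≡ = Fin.punchIn-punchOut (c≢d ∘ sym)
      rᵢ = rowSum A i
      rⱼ = rowSum A j
      Aᵢ = minor A i c
      Aⱼ = minor A j d
      X = per (minor Aᵢ j′ d′)
      X≡ : per (minor Aⱼ i′ c′) ≡ X
      X≡ = per-cong (λ a b → sym (cong₂ A (punchIn-comm i j i≢j (i≢j ∘ sym) a) (punchIn-comm c d c≢d (c≢d ∘ sym) b)))
      0<rⱼ : 0 < rⱼ
      0<rⱼ = per-pos⇒rowSum-pos A 0<p j
      0<rᵢ : 0 < rᵢ
      0<rᵢ = per-pos⇒rowSum-pos A 0<p i
      pᵢ : rᵢ * per Aᵢ ≡ per A
      pᵢ = tight⇒per-minor n<N A A≤1 0<p tight Aic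
      pⱼ : rⱼ * per Aⱼ ≡ per A
      pⱼ = tight⇒per-minor n<N A A≤1 0<p tight Ajd
      0<pᵢ : 0 < per Aᵢ
      0<pᵢ = *-posʳ rᵢ (subst (0 <_) (sym pᵢ) 0<p)
      0<pⱼ : 0 < per Aⱼ
      0<pⱼ = *-posʳ rⱼ (subst (0 <_) (sym pⱼ) 0<p)
      n≤N′ = ≤-trans (n≤1+n n) n<N
      pᵢⱼ : (rⱼ ∸ 1) * X ≡ per Aᵢ
      pᵢⱼ = subst (λ r → r * X ≡ per Aᵢ)
        (trans (rowSum-minor A i c j′) (trans (cong (λ j → rowSum A j ∸ A j c) j≡) (cong (rⱼ ∸_) Ajc)))
        (tight⇒per-minor n≤N′ Aᵢ (λ _ _ → A≤1 _ _) 0<pᵢ (tight-minor n<N A A≤1 0<p tight Aic)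
          (trans (cong₂ A j≡ d≡) Ajd))
      pⱼᵢ : rᵢ * X ≡ per Aⱼ
      pⱼᵢ = subst₂ (λ r x → r * x ≡ per Aⱼ)
        (trans (rowSum-minor A j d i′) (trans (cong (λ i → rowSum A i ∸ A i d) i≡) (cong (rᵢ ∸_) Aid))) X≡
        (tight⇒per-minor n≤N′ Aⱼ (λ _ _ → A≤1 _ _) 0<pⱼ (tight-minor n<N A A≤1 0<p tight Ajd)
          (trans (cong₂ A i≡ c≡) Aic))
      0<X : 0 < X
      0<X = *-posʳ (rⱼ ∸ 1) (subst (0 <_) (sym pᵢⱼ) 0<pᵢ)
      p≡ : rᵢ * X * (rⱼ ∸ 1) ≡ rᵢ * X * rⱼ
      p≡ = begin
        rᵢ * X * (rⱼ ∸ 1)   ≡⟨ eq rᵢ X (rⱼ ∸ 1) ⟩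
        rᵢ * ((rⱼ ∸ 1) * X) ≡⟨ cong (rᵢ *_) pᵢⱼ ⟩
        rᵢ * per Aᵢ         ≡⟨ trans pᵢ (sym pⱼ) ⟩
        rⱼ * per Aⱼ         ≡⟨ cong (rⱼ *_) pⱼᵢ ⟨
        rⱼ * (rᵢ * X)       ≡⟨ *-comm rⱼ (rᵢ * X) ⟩
        rᵢ * X * rⱼ         ∎
        where
        open ≡-Reasoning
        eq : ∀ a b c → a * b * c ≡ a * (c * b)
        eq = solve-∀

  -- Log-concavity of G

  G-power-* : ∀ {r} → r ≤ N → ∀ e k → r * k ≡ e → G r ^ e ≡ ((r !) ^ k) ^ L
  G-power-* {r} r≤N e k rk≡e = begin
    G r ^ e           ≡⟨ cong (G r ^_) rk≡e ⟨
    G r ^ (r * k)     ≡⟨ ^-*-assoc (G r) r k ⟨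
    (G r ^ r) ^ k     ≡⟨ cong (_^ k) (G-power r≤N) ⟩
    ((r !) ^ L) ^ k   ≡⟨ ^-swap (r !) L k ⟩
    ((r !) ^ k) ^ L   ∎
    where open ≡-Reasoning

  -- The argument starts at 1 because G 1 = 1 < G 2: with the value 1 at 0, the inequality would
  -- fail there. Empty rows must therefore be excluded whenever it is used.
  G-log-concave : ∀ a → let b = suc a in 2 + b ≤ N → G b * G (2 + b) < G (1 + b) * G (1 + b)
  G-log-concave a d≤N = ^-cancelʳ-< e (subst₂ _<_ (sym lhs) (sym rhs) (^-monoˡ-< L (!-log-concave a)))
    where
    b = suc a
    c = suc b
    d = suc c
    e = b * c * d
    c≤N = ≤-trans (n≤1+n c) d≤N
    b≤N = ≤-trans (n≤1+n b) c≤N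
    eq₁ : ∀ b c d → c * (b * d) ≡ b * c * d
    eq₁ = solve-∀
    lhs : (G b * G d) ^ e ≡ ((b !) ^ (c * d) * (d !) ^ (b * c)) ^ L
    lhs = trans (^-distribʳ-* (G b) (G d) e) (trans
      (cong₂ _*_ (G-power-* b≤N e (c * d) (sym (*-assoc b c d))) (G-power-* d≤N e (b * c) (*-comm d (b * c))))
      (sym (^-distribʳ-* ((b !) ^ (c * d)) _ L)))
    y : G c ^ e ≡ ((c !) ^ (b * d)) ^ L
    y = G-power-* c≤N e (b * d) (eq₁ b c d)
    rhs : (G c * G c) ^ e ≡ ((c !) ^ (b * d) * (c !) ^ (b * d)) ^ L
    rhs = trans (^-distribʳ-* (G c) (G c) e) (trans (cong₂ _*_ y y) (sym (^-distribʳ-* ((c !) ^ (b * d)) _ L)))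

  -- Log-concavity says that the ratios G(x + 1)/G(x) strictly decrease; here the ratio at 1 + d + b
  -- is compared with the ratio at b.
  G-spread : ∀ a d → let b = suc a in 2 + d + b ≤ N → G b * G (2 + d + b) < G (1 + b) * G (1 + d + b)
  G-spread a zero    h = G-log-concave a h
  G-spread a (suc d) h = *-cancelˡ-<⁺ (G (2 + d + b) * G (1 + d + b)) (subst₂ _<_
    (eq₁ (G b) (G (2 + d + b)) (G (1 + d + b)) (G (3 + d + b)))
    (eq₂ (G (1 + b)) (G (1 + d + b)) (G (2 + d + b)))
    (*-mono-< (G-spread a d (≤-trans (n≤1+n _) h)) (G-log-concave (d + suc a) h)))
    where
    b = suc a
    eq₁ : ∀ x y z w → x * y * (z * w) ≡ y * z * (x * w)
    eq₁ = solve-∀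
    eq₂ : ∀ x y z → x * y * (z * z) ≡ z * y * (x * z)
    eq₂ = solve-∀

  -- Each use of `G-spread` moves both arguments one place towards their mean, which k such moves
  -- reach.
  G-center : ∀ a k → let b = suc a in k + (k + b) ≤ N → G b * G (k + (k + b)) ≤ G (k + b) * G (k + b)
  G-center-< : ∀ a k′ → let b = suc a; k = suc k′ in k + (k + b) ≤ N → G b * G (k + (k + b)) < G (k + b) * G (k + b)
  G-center a zero    h = ≤-refl
  G-center a (suc k) h = <⇒≤ (G-center-< a k h)
  G-center-< a k h = <-≤-trans
    (subst (λ x → G b * G (suc x) < G (1 + b) * G x) (eq k b)
      (G-spread a (k + k) (subst (λ x → suc x ≤ N) (sym (eq k b)) h)))
    (subst (λ x → G (1 + b) * G (k + x) ≤ G x * G x) (+-suc k b)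
      (G-center (suc a) k (subst (λ x → k + x ≤ N) (sym (+-suc k b)) (≤-trans (n≤1+n _) h))))
    where
    b = suc a
    eq : ∀ k b → 1 + (k + k) + b ≡ k + suc (k + b)
    eq = solve-∀

  private
    G-middle′ : ∀ {m r s} → m + m ≤ N → 0 < r → r ≤ m → r + s ≡ m + m →
      G r * G s ≤ G m * G m × (G r * G s ≡ G m * G m → r ≡ m)
    G-middle′ {m} {r@(suc r′)} {s} 2m≤N _ r≤m r+s≡2m = go (m ∸ r) (m∸n+n≡m r≤m)
      where
      s≡ : ∀ k → k + r ≡ m → s ≡ k + (k + r)
      s≡ k refl = +-cancelˡ-≡ r _ _ (trans r+s≡2m (eq k r))
        where
        eq : ∀ k r → k + r + (k + r) ≡ r + (k + (k + r))
        eq = solve-∀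
      k≤ : ∀ k → k + r ≡ m → k + (k + r) ≤ N
      k≤ k k+r≡m = ≤-trans (≤-trans (≤-reflexive (sym (s≡ k k+r≡m))) (≤-trans (m≤n+m s r) (≤-reflexive r+s≡2m))) 2m≤N
      go : ∀ k → k + r ≡ m → G r * G s ≤ G m * G m × (G r * G s ≡ G m * G m → r ≡ m)
      go k k+r≡m = subst₂ (λ s m → G r * G s ≤ G m * G m) (sym (s≡ k k+r≡m)) k+r≡m (G-center r′ k (k≤ k k+r≡m)) , tight k k+r≡m
        where
        tight : ∀ k → k + r ≡ m → G r * G s ≡ G m * G m → r ≡ m
        tight zero    r≡m   _  = r≡m
        tight (suc k) k+r≡m eq = contradiction eq (<⇒≢ (subst₂ (λ s m → G r * G s < G m * G m)
          (sym (s≡ (suc k) k+r≡m)) k+r≡m (G-center-< r′ k (k≤ (suc k) k+r≡m))))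

  G-middle : ∀ {m r s} → m + m ≤ N → 0 < r → 0 < s → r + s ≡ m + m →
    G r * G s ≤ G m * G m × (G r * G s ≡ G m * G m → r ≡ m)
  G-middle {m} {r} {s} 2m≤N 0<r 0<s r+s≡2m with ≤-total r m
  ... | inj₁ r≤m = G-middle′ 2m≤N 0<r r≤m r+s≡2m
  ... | inj₂ m≤r with s≤m ← +-cancelˡ-≤ m s m (≤-trans (+-monoˡ-≤ s m≤r) (≤-reflexive r+s≡2m))
                 with le , tight ← G-middle′ {m} {s} {r} 2m≤N 0<s s≤m (trans (+-comm s r) r+s≡2m)
      = subst (_≤ G m * G m) (*-comm (G s) (G r)) le
      , λ eq → +-cancelʳ-≡ m r m (trans (cong (r +_) (sym (tight (trans (*-comm (G s) (G r)) eq)))) r+s≡2m)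

-- The product of the permanents of two complementary matrices

module ComplementaryPair (m : ℕ) where
  N L : ℕ
  N = m + m
  L = N !

  instance
    L≢0 : NonZero L
    L≢0 = N !≢0

  -- `L / r` is exact for 0 < r ≤ N. The value at 0 stands for rows emptied by deleting a column;
  -- being positive, it can be cancelled in `∏z`.
  G : ℕ → ℕ
  G zero      = 1
  G r@(suc _) = (r !) ^ (L / r)

  0<G : ∀ r → 0 < G r
  0<G zero      = z<s
  0<G r@(suc _) = ^-pos (L / r) (>-nonZero⁻¹ (r !) {{r !≢0}})

  G-power : ∀ {r} → r ≤ N → G r ^ r ≡ (r !) ^ L
  G-power {zero}      _   = sym (^-zeroˡ L)
  G-power {r@(suc s)} r≤N = trans (^-*-assoc (r !) (L / r) r)
    (cong ((r !) ^_) (m/n*n≡m (∣-trans (m∣m*n (s !)) (m≤n⇒m!∣n! r≤N))))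

  open Bregman N L G 0<G G-power public

  module _ (A C : Matrix N) (A+C≡1 : ∀ i j → A i j + C i j ≡ 1) where
    A≤1 : Binary A
    A≤1 i j = ≤-trans (m≤m+n _ _) (≤-reflexive (A+C≡1 i j))

    C≤1 : Binary C
    C≤1 i j = ≤-trans (m≤n+m _ _) (≤-reflexive (A+C≡1 i j))

    rowSum-+ : ∀ i → rowSum A i + rowSum C i ≡ N
    rowSum-+ i = trans (sym (∑-distrib-+ (A i) (C i)))
      (trans (sum-cong-≗ (A+C≡1 i)) (trans (∑-const N 1) (*-identityʳ N)))

    private
      -- The exponent 4 of the theorem: `G m` occurs 2 N = 4 m times, and `G m ^ m` is `(m !) ^ L`.
      ∏G² : ∏ {N} (λ _ → G m * G m) ≡ ((m !) ^ 4) ^ L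
      ∏G² = begin
        ∏ {N} (λ _ → G m * G m)      ≡⟨ ∏-const N _ ⟩
        (G m * G m) ^ N              ≡⟨ ^-distribˡ-+-* (G m * G m) m m ⟩
        (G m * G m) ^ m * (G m * G m) ^ m ≡⟨ cong (λ x → x * x) (trans (^-distribʳ-* (G m) (G m) m) (cong (λ x → x * x) (G-power (m≤m+n m m)))) ⟩
        (m !) ^ L * (m !) ^ L * ((m !) ^ L * (m !) ^ L) ≡⟨ eq ((m !) ^ L) ⟩
        ((m !) ^ L) ^ 4              ≡⟨ ^-swap (m !) L 4 ⟩
        ((m !) ^ 4) ^ L              ∎
        where
        open ≡-Reasoning
        eq : ∀ x → x * x * (x * x) ≡ x * (x * (x * (x * 1)))
        eq = solve-∀

    module _ (0<p : 0 < per A) (0<q : 0 < per C) where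
      private
        row : ∀ i → G (rowSum A i) * G (rowSum C i) ≤ G m * G m ×
                    (G (rowSum A i) * G (rowSum C i) ≡ G m * G m → rowSum A i ≡ m)
        row i = G-middle ≤-refl (per-pos⇒rowSum-pos A 0<p i) (per-pos⇒rowSum-pos C 0<q i) (rowSum-+ i)

        ∏rows : ∏ (λ i → G (rowSum A i) * G (rowSum C i)) ≡ bound A * bound C
        ∏rows = ∏-distrib-* (G ∘ rowSum A) (G ∘ rowSum C)

        bounds : bound A * bound C ≤ ((m !) ^ 4) ^ L
        bounds = subst₂ _≤_ ∏rows ∏G² (∏-mono (proj₁ ∘ row))

        pq^L : (per A * per C) ^ L ≤ bound A * bound C
        pq^L = ≤-trans (≤-reflexive (^-distribʳ-* (per A) (per C) L))
          (*-mono-≤ (bregman ≤-refl A A≤1) (bregman ≤-refl C C≤1))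

      per*per-bound⁺ : per A * per C ≤ (m !) ^ 4
      per*per-bound⁺ = ^-cancelʳ-≤ L (≤-trans pq^L bounds)

      -- The chain through `bound A * bound C` collapses. Its first half separates into the two
      -- Bregman bounds, its second into the rows, where `G-middle` identifies the row sum.
      per*per-tight⁺ : per A * per C ≡ (m !) ^ 4 → Tight A × (∀ i → rowSum A i ≡ m)
      per*per-tight⁺ eq = proj₁ (*-tight (bregman ≤-refl A A≤1) (bregman ≤-refl C C≤1)
            (^-pos L 0<p) (^-pos L 0<q) (trans (sym (^-distribʳ-* (per A) (per C) L)) lower)) ,
          λ i → proj₂ (row i) (∏-tight (λ i → *-pos (0<G (rowSum A i)) (0<G (rowSum C i))) (proj₁ ∘ row)
            (trans ∏rows (trans (sym lower) (trans (cong (_^ L) eq) (sym ∏G²)))) i)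
        where
        lower : (per A * per C) ^ L ≡ bound A * bound C
        lower = ≤-antisym pq^L (≤-trans bounds (≤-reflexive (cong (_^ L) (sym eq))))

    per*per-bound : per A * per C ≤ (m !) ^ 4
    per*per-bound with per A in p | per C in q
    -- Only positive permanents ensure that both matrices have no empty row, as `G-middle` demands;
    -- otherwise the product is 0.
    ... | zero  | _     = z≤n
    ... | suc p′ | zero  = ≤-trans (≤-reflexive (*-zeroʳ p′)) z≤n
    ... | suc _ | suc _ = subst₂ (λ p q → p * q ≤ (m !) ^ 4) p q
          (per*per-bound⁺ (subst (0 <_) (sym p) z<s) (subst (0 <_) (sym q) z<s))

    module _ (eq : per A * per C ≡ (m !) ^ 4) where
      private
        0<pq : 0 < per A * per C
        0<pq = subst (0 <_) (sym eq) (^-pos 4 (>-nonZero⁻¹ (m !) {{m !≢0}}))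

      per*per-pos : 0 < per A
      per*per-pos = *-posˡ (per A) 0<pq

      per*per-tight : Tight A × (∀ i → rowSum A i ≡ m)
      per*per-tight = per*per-tight⁺ per*per-pos (*-posʳ (per A) 0<pq) eq

-- Bipartite tournaments

⟦_⟧ : Bool → ℕ
⟦ b ⟧ = if b then 1 else 0

⟦⟧-injective : ∀ {a b} → ⟦ a ⟧ ≡ ⟦ b ⟧ → a ≡ b
⟦⟧-injective {true}  {true}  _ = refl
⟦⟧-injective {false} {false} _ = refl

count : (Fin n → Bool) → ℕ
count p = ∑ (λ i → ⟦ p i ⟧)

count≤ : (p : Fin n → Bool) → count p ≤ n
count≤ {n} p = ≤-trans (∑-mono (λ i → le (p i))) (≤-reflexive (trans (∑-const n 1) (*-identityʳ n)))
  where
  le : ∀ b → ⟦ b ⟧ ≤ 1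
  le true  = ≤-refl
  le false = z≤n

count⇒permutation : (p q : Fin n → Bool) → count p ≡ count q →
  ∃ λ (π : Permutation′ n) → ∀ i → p i ≡ q (π ⟨$⟩ʳ i)
count⇒permutation {zero}  p q _  = Perm.id , λ ()
count⇒permutation {suc n} p q eq with Fin.any? (λ k → q k Bool.≟ p zero)
... | yes (k , qk≡p₀) with count⇒permutation (p ∘ suc) (q ∘ punchIn k)
        (+-cancelˡ-≡ ⟦ p zero ⟧ _ _ (trans eq (trans (sum-remove {i = k} (λ i → ⟦ q i ⟧)) (cong (λ b → ⟦ b ⟧ + count (q ∘ punchIn k)) qk≡p₀))))
...   | π , p≡qπ = insert zero k π , λ { zero → sym qk≡p₀ ; (suc i) → p≡qπ i }
-- If q never takes the value `p zero`, it is constant: its count is then 0 against a positive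
-- count, or n + 1 against at most n.
count⇒permutation {suc n} p q eq | no ∄k with p zero in p₀
... | true  = contradiction (trans eq (trans (sum-cong-≗ (λ k → cong ⟦_⟧ (Bool.¬-not (λ e → ∄k (k , e)))))
                (trans (∑-const (suc n) 0) (*-zeroʳ n)))) λ ()
... | false = contradiction (trans eq (trans (sum-cong-≗ (λ k → cong ⟦_⟧ (Bool.¬-not (λ e → ∄k (k , e)))))
                (trans (∑-const (suc n) 1) (*-identityʳ (suc n))))) (<⇒≢ (s≤s (count≤ (p ∘ suc))))

-- Permanents of adjacency matrices

conjugate : (Fin n ⊎ Fin n) ↔ (Fin n ⊎ Fin n) → Permutation′ (n + n)
conjugate {n} f = permutation (join n n ∘ to ∘ splitAt n) (join n n ∘ from ∘ splitAt n)
  (λ u → trans (cong (join n n ∘ to) (Fin.splitAt-join n n _))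
    (trans (cong (join n n) (strictlyInverseˡ _)) (Fin.join-splitAt n n u)))
  (λ u → trans (cong (join n n ∘ from) (Fin.splitAt-join n n _))
    (trans (cong (join n n) (strictlyInverseʳ _)) (Fin.join-splitAt n n u)))
  where open Inverse f

per-splitAt : (Fin n ⊎ Fin n → Fin n ⊎ Fin n → ℕ) → ℕ
per-splitAt {n} M = per (λ u v → M (splitAt n u) (splitAt n v))

-- Rows and columns are relabelled separately to serve two ends: f = g for isomorphic digraphs, and
-- a swap of the columns alone to turn zero diagonal blocks into off-diagonal ones.
per-conjugate : (M : Fin n ⊎ Fin n → Fin n ⊎ Fin n → ℕ) (f g : (Fin n ⊎ Fin n) ↔ (Fin n ⊎ Fin n)) →
  per-splitAt (λ s t → M (Inverse.to f s) (Inverse.to g t)) ≡ per-splitAt M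
per-conjugate {n} M f g = begin
  per-splitAt (λ s t → M (Inverse.to f s) (Inverse.to g t)) ≡⟨ per-cong {n + n} (λ u v → sym (cong₂ M (Fin.splitAt-join n n (Inverse.to f (splitAt n u))) (Fin.splitAt-join n n (Inverse.to g (splitAt n v))))) ⟩
  per (λ u v → A (conjugate f ⟨$⟩ʳ u) (conjugate g ⟨$⟩ʳ v)) ≡⟨ per-permute-rows (λ u v → A u (conjugate g ⟨$⟩ʳ v)) (conjugate f) ⟩
  per (λ u v → A u (conjugate g ⟨$⟩ʳ v))                    ≡⟨ per-permute-columns A (conjugate g) ⟩
  per A                                                     ∎
  where
  open ≡-Reasoning
  A : Matrix (n + n)
  A u v = M (splitAt n u) (splitAt n v)

swap↔ : {A : Set} → (A ⊎ A) ↔ (A ⊎ A)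
swap↔ = mk↔ₛ′ Sum.swap Sum.swap swap-involutive swap-involutive

id↔ : {A : Set} → A ↔ A
id↔ = mk↔ₛ′ id id (λ _ → refl) (λ _ → refl)

per-antiblock : (M : Fin n ⊎ Fin n → Fin n ⊎ Fin n → ℕ) → (∀ i j → M (inj₁ i) (inj₁ j) ≡ 0) →
  per-splitAt M ≡ per (λ i j → M (inj₁ i) (inj₂ j)) * per (λ i j → M (inj₂ i) (inj₁ j))
per-antiblock {n} M M₁₁≡0 = trans (sym (per-conjugate M id↔ swap↔)) (per-block n (λ s t → M s (Sum.swap t)) M₁₁≡0)

-- Both are indexed by x first, so that they add up to the all-ones matrix; the Y to X block of the
-- adjacency matrix is the transpose of `YX`.
XY YX : BipartiteTournament n → Matrix n
XY T i j = ⟦ isX⇒Y (T i j) ⟧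
YX T i j = ⟦ isY⇒X (T i j) ⟧

XY+YX : (T : BipartiteTournament n) → ∀ i j → XY T i j + YX T i j ≡ 1
XY+YX T i j with T i j
... | X⇒Y = refl
... | Y⇒X = refl

per-adjacency : (T : BipartiteTournament n) → per (adjacency T) ≡ per (XY T) * per (YX T)
per-adjacency T = trans (per-antiblock (λ s t → ⟦ digraph T s t ⟧) (λ _ _ → refl))
  (cong (per (XY T) *_) (per-transpose (YX T)))

per-≅ : (T U : BipartiteTournament n) → digraph T ≅ digraph U → per (adjacency T) ≡ per (adjacency U)
per-≅ {n} T U (f , T≡U) = trans
  (per-cong (λ u v → cong ⟦_⟧ (T≡U (splitAt n u) (splitAt n v))))
  (per-conjugate (λ s t → ⟦ digraph U s t ⟧) f f)

-- The extremal tournament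

isLeft : {A B : Set} → A ⊎ B → Bool
isLeft (inj₁ _) = true
isLeft (inj₂ _) = false

half : ∀ m → (m + m) / 2 ≡ m
half m = trans (cong (_/ 2) (eq m)) (m*n/n≡m m 2)
  where
  eq : ∀ m → m + m ≡ m * 2
  eq = solve-∀

inFirstHalf≡isLeft : ∀ m (i : Fin (m + m)) → inFirstHalf i ≡ isLeft (splitAt m i)
inFirstHalf≡isLeft m i = trans (cong (toℕ i <ᵇ_) (half m)) (go m i)
  where
  go : ∀ m {k} (i : Fin (m + k)) → (toℕ i <ᵇ m) ≡ isLeft (splitAt m i)
  go zero    i       = refl
  go (suc m) zero    = refl
  go (suc m) (suc i) = trans (go m i) (eq (splitAt m i))
    where
    eq : ∀ s → isLeft s ≡ isLeft (Sum.map₁ suc s)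
    eq (inj₁ _) = refl
    eq (inj₂ _) = refl

count-inFirstHalf : ∀ m → count (inFirstHalf {m + m}) ≡ m
count-inFirstHalf m = begin
  count (inFirstHalf {m + m})                ≡⟨ sum-cong-≗ (cong ⟦_⟧ ∘ inFirstHalf≡isLeft m) ⟩
  ∑ (λ i → ⟦ isLeft (splitAt m {m} i) ⟧)     ≡⟨ ∑-split m {m} (λ i → ⟦ isLeft (splitAt m {m} i) ⟧) ⟩
  ∑ (λ i → ⟦ isLeft (splitAt m (i ↑ˡ m)) ⟧) + ∑ (λ j → ⟦ isLeft (splitAt m {m} (m ↑ʳ j)) ⟧)
    ≡⟨ cong₂ _+_ (sum-cong-≗ {m} (λ i → cong (⟦_⟧ ∘ isLeft) (Fin.splitAt-↑ˡ m i m))) (sum-cong-≗ {m} (λ j → cong (⟦_⟧ ∘ isLeft) (Fin.splitAt-↑ʳ m m j))) ⟩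
  ∑ {m} (λ _ → 1) + ∑ {m} (λ _ → 0)          ≡⟨ cong₂ _+_ (trans (∑-const m 1) (*-identityʳ m)) (trans (∑-const m 0) (*-zeroʳ m)) ⟩
  m + 0                                      ≡⟨ +-identityʳ m ⟩
  m                                          ∎
  where open ≡-Reasoning

per-BT₀ : ∀ m → per (adjacency (BT₀ (m + m))) ≡ (m !) ^ 4
per-BT₀ m = begin
  per (adjacency (BT₀ (m + m)))                      ≡⟨ per-adjacency (BT₀ (m + m)) ⟩
  -- `XY` consists of two diagonal all-ones blocks of order m and `YX` of two off-diagonal ones,
  -- giving four factors m!.
  per (XY (BT₀ (m + m))) * per (YX (BT₀ (m + m)))    ≡⟨ cong₂ _*_ (trans (blocks isX⇒Y) (per-block m {m} (λ s t → ⟦ isX⇒Y (fromHalves (isLeft s) (isLeft t)) ⟧) (λ _ _ → refl)))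
                                                                  (trans (blocks isY⇒X) (per-antiblock {m} (λ s t → ⟦ isY⇒X (fromHalves (isLeft s) (isLeft t)) ⟧) (λ _ _ → refl))) ⟩
  ones * ones * (ones * ones)                        ≡⟨ cong (λ x → x * x * (x * x)) (per-ones m) ⟩
  (m !) * (m !) * ((m !) * (m !))                    ≡⟨ eq (m !) ⟩
  (m !) ^ 4                                          ∎
  where
  open ≡-Reasoning
  ones = per {m} (λ _ _ → 1)
  blocks : (g : Direction → Bool) → per (λ i j → ⟦ g (BT₀ (m + m) i j) ⟧) ≡
    per-splitAt {m} (λ s t → ⟦ g (fromHalves (isLeft s) (isLeft t)) ⟧)
  blocks g = per-cong (λ i j → cong (⟦_⟧ ∘ g) (cong₂ fromHalves (inFirstHalf≡isLeft m i) (inFirstHalf≡isLeft m j)))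
  eq : ∀ x → x * x * (x * x) ≡ x * (x * (x * (x * 1)))
  eq = solve-∀

halves⇒≅BT₀ : (T : BipartiteTournament n) (p q : Fin n → Bool) → (∀ i j → T i j ≡ fromHalves (p i) (q j)) →
  count p ≡ count (inFirstHalf {n}) → count q ≡ count (inFirstHalf {n}) → digraph T ≅ digraph (BT₀ n)
halves⇒≅BT₀ {n} T p q T≡ ∣p∣ ∣q∣
  with π , p≡ ← count⇒permutation p inFirstHalf ∣p∣
     | σ , q≡ ← count⇒permutation q inFirstHalf ∣q∣
  = (π ⊎-↔ σ) , iso
  where
  edge : ∀ i j → T i j ≡ BT₀ n (π ⟨$⟩ʳ i) (σ ⟨$⟩ʳ j)
  edge i j = trans (T≡ i j) (cong₂ fromHalves (p≡ i) (q≡ j))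
  iso : ∀ u v → digraph T u v ≡ digraph (BT₀ n) (Inverse.to (π ⊎-↔ σ) u) (Inverse.to (π ⊎-↔ σ) v)
  iso x[ i ] x[ _ ] = refl
  iso x[ i ] y[ j ] = cong isX⇒Y (edge i j)
  iso y[ j ] x[ i ] = cong isY⇒X (edge i j)
  iso y[ j ] y[ _ ] = refl

-- Rows sharing the column j₀ with row i₀ coincide with row i₀, and the others
-- are its complement.
module BlockStructure (T : BipartiteTournament (m + m))
  (rowSum≡m : ∀ i → rowSum (XY T) i ≡ m)
  (shared : ∀ {i j c d} → XY T i c ≡ 1 → XY T j c ≡ 1 → XY T j d ≡ 1 → XY T i d ≡ 1)
  (i₀ j₀ : Fin (m + m)) (A₀₀ : XY T i₀ j₀ ≡ 1) where

  private
    A = XY T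

    A≤1 : Binary A
    A≤1 i j = ≤-trans (m≤m+n _ _) (≤-reflexive (XY+YX T i j))

    same : ∀ i → A i j₀ ≡ 1 → ∀ j → A i j ≡ A i₀ j
    same i Ai0 j with zero-or-one (A≤1 i j) | zero-or-one (A≤1 i₀ j)
    ... | inj₁ a | inj₁ b = trans a (sym b)
    ... | inj₂ a | inj₂ b = trans a (sym b)
    ... | inj₁ a | inj₂ b = contradiction (trans (sym a) (shared Ai0 A₀₀ b)) λ ()
    ... | inj₂ a | inj₁ b = contradiction (trans (sym b) (shared A₀₀ Ai0 a)) λ ()

    -- A common column of rows i and i₀ would, by `shared`, put a 1 at (i, j₀). The two rows are
    -- thus disjoint, and their 2m ones fill all 2m columns.
    complement : ∀ i → A i j₀ ≡ 0 → ∀ j → A i j + A i₀ j ≡ 1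
    complement i Ai0 = ∑-tight le (begin
      ∑ (λ j → A i j + A i₀ j)  ≡⟨ ∑-distrib-+ (A i) (A i₀) ⟩
      rowSum A i + rowSum A i₀  ≡⟨ cong₂ _+_ (rowSum≡m i) (rowSum≡m i₀) ⟩
      m + m                     ≡⟨ trans (∑-const (m + m) 1) (*-identityʳ (m + m)) ⟨
      ∑ {m + m} (λ _ → 1)       ∎)
      where
      open ≡-Reasoning
      le : ∀ j → A i j + A i₀ j ≤ 1
      le j with zero-or-one (A≤1 i j) | zero-or-one (A≤1 i₀ j)
      ... | inj₁ a | _      = ≤-trans (≤-reflexive (cong (_+ A i₀ j) a)) (A≤1 i₀ j)
      ... | inj₂ a | inj₁ b = ≤-reflexive (cong₂ _+_ a b)
      ... | inj₂ a | inj₂ b = contradiction (trans (sym Ai0) (shared a b A₀₀)) λ ()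

    halves-dir : ∀ d e f → (⟦ isX⇒Y d ⟧ ≡ 1 → ⟦ isX⇒Y e ⟧ ≡ ⟦ isX⇒Y f ⟧) →
      (⟦ isX⇒Y d ⟧ ≡ 0 → ⟦ isX⇒Y e ⟧ + ⟦ isX⇒Y f ⟧ ≡ 1) → e ≡ fromHalves (isX⇒Y d) (isX⇒Y f)
    halves-dir X⇒Y X⇒Y X⇒Y _ _ = refl
    halves-dir X⇒Y Y⇒X Y⇒X _ _ = refl
    halves-dir X⇒Y X⇒Y Y⇒X s _ = contradiction (s refl) λ ()
    halves-dir X⇒Y Y⇒X X⇒Y s _ = contradiction (s refl) λ ()
    halves-dir Y⇒X X⇒Y Y⇒X _ _ = refl
    halves-dir Y⇒X Y⇒X X⇒Y _ _ = refl
    halves-dir Y⇒X X⇒Y X⇒Y _ c = contradiction (c refl) λ ()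
    halves-dir Y⇒X Y⇒X Y⇒X _ c = contradiction (c refl) λ ()

  halves : ∀ i j → T i j ≡ fromHalves (isX⇒Y (T i j₀)) (isX⇒Y (T i₀ j))
  halves i j = halves-dir (T i j₀) (T i j) (T i₀ j) (λ e → same i e j) (λ e → complement i e j)

-- The upper bound and uniqueness of the maximiser

module _ (m : ℕ) where
  open ComplementaryPair m

  per-adjacency-bound : (T : BipartiteTournament N) → per (adjacency T) ≤ (m !) ^ 4
  per-adjacency-bound T = ≤-trans (≤-reflexive (per-adjacency T)) (per*per-bound (XY T) (YX T) (XY+YX T))

  per-adjacency-max⇒≅BT₀ : 0 < m → (T : BipartiteTournament N) →
    per (adjacency T) ≡ (m !) ^ 4 → digraph T ≅ digraph (BT₀ N)
  per-adjacency-max⇒≅BT₀ 0<m T max = halves⇒≅BT₀ T (λ i → isX⇒Y (T i j₀)) (λ j → isX⇒Y (T i₀ j))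
    (BlockStructure.halves T rowSum≡m shared i₀ j₀ A₀₀)
    (trans (colSum≡m j₀) (sym (count-inFirstHalf m)))
    (trans (rowSum≡m i₀) (sym (count-inFirstHalf m)))
    where
    A = XY T
    C = YX T
    eq : per A * per C ≡ (m !) ^ 4
    eq = trans (sym (per-adjacency T)) max
    tight : Tight A
    tight = proj₁ (per*per-tight A C (XY+YX T) eq)
    rowSum≡m : ∀ i → rowSum A i ≡ m
    rowSum≡m = proj₂ (per*per-tight A C (XY+YX T) eq)
    -- The size of the first half of X is the sum of column j₀, so the equality case is also applied
    -- to the transposed pair.
    colSum≡m : ∀ j → rowSum (transpose A) j ≡ m
    colSum≡m = proj₂ (per*per-tight (transpose A) (transpose C) (λ i j → XY+YX T j i)
      (trans (cong₂ _*_ (per-transpose A) (per-transpose C)) eq))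
    shared : ∀ {i j c d} → A i c ≡ 1 → A j c ≡ 1 → A j d ≡ 1 → A i d ≡ 1
    shared = tight⇒shared-column⇒⊆ ≤-refl A (A≤1 A C (XY+YX T)) (per*per-pos A C (XY+YX T) eq) tight
    i₀ : Fin N
    i₀ = subst Fin (suc-pred N {{>-nonZero (≤-trans 0<m (m≤m+n m m))}}) zero
    j₀∃ : ∃ λ j → 0 < A i₀ j
    j₀∃ = ∑-pos⇒term-pos (A i₀) (subst (0 <_) (sym (rowSum≡m i₀)) 0<m)
    j₀ : Fin N
    j₀ = proj₁ j₀∃
    A₀₀ : A i₀ j₀ ≡ 1
    A₀₀ = ≤-antisym (A≤1 A C (XY+YX T) i₀ j₀) (proj₂ j₀∃)

theorem9 : (n : ℕ) → 0 < n → 2 ∣ n →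
    (ρ n ≡ ((n / 2) !) ^ 4) ×
    ((T : BipartiteTournament n) →
    (per (adjacency T) ≡ ρ n) ⇔ (digraph T ≅ digraph (BT₀ n)))
theorem9 n 0<n (divides m n≡m*2) = subst Claim (sym n≡2m) claim
  where
  n≡2m : n ≡ m + m
  n≡2m = trans n≡m*2 (trans (*-comm m 2) (cong (m +_) (+-identityʳ m)))

  0<m : 0 < m
  0<m = *-posˡ m (subst (0 <_) n≡m*2 0<n)

  Claim : ℕ → Set
  Claim n = (ρ n ≡ ((n / 2) !) ^ 4) ×
    ((T : BipartiteTournament n) → (per (adjacency T) ≡ ρ n) ⇔ (digraph T ≅ digraph (BT₀ n)))

  ρ≡ : ρ (m + m) ≡ (m !) ^ 4
  ρ≡ with T , per≡ρ ← ρ-attained (m + m) = ≤-antisym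
    (≤-trans (≤-reflexive (sym per≡ρ)) (per-adjacency-bound m T))
    (≤-trans (≤-reflexive (sym (per-BT₀ m))) (ρ-upper (BT₀ (m + m))))

  claim : Claim (m + m)
  claim = trans ρ≡ (cong (λ k → (k !) ^ 4) (sym (half m))) , λ T → mk⇔
    (λ max → per-adjacency-max⇒≅BT₀ m 0<m T (trans max ρ≡))
    (λ T≅BT₀ → trans (per-≅ T (BT₀ (m + m)) T≅BT₀) (trans (per-BT₀ m) (sym ρ≡)))
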